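{- For every integer $n\geqslant 2$ and every tuple $\mathbf{m}=(m_1,\ldots,m_n)$ of positive integers there exist positive real constants $\tilde C_1(\mathbf{m},n)$ and $\tilde C_2(\mathbf{m},n)$, depending only on $n$ and $\mathbf{m}$, such that the following holds. Let $t$ be a positive integer, let $G=\{x\in\mathbb{C}\mid x^t=1\}\subset\mathbb{C}^*$, let $G_1,\ldots,G_n$ be cosets of $G$ in $\mathbb{C}^*$, and let $f_1(x),\ldots,f_n(x)\in\mathbb{C}[x]$ be an admissible set of polynomials with $\deg f_i=m_i$ for $i=1,\ldots,n$. Suppose that $$|G|>\tilde C_1(\mathbf{m},n).$$ Then the set $$M=\{x\in\mathbb{C}\mid f_i(x)\in G_i,\ i=1,\ldots,n\}$$ satisfies $$|M|\leqslant \tilde C_2(\mathbf{m},n)\,|G|^{\frac12+\frac1{2n}}.$$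
   Context: A set (tuple) of polynomials $f_1(x),\ldots,f_n(x)\in\mathbb{C}[x]$ is called admissible if there exist $x_1,\ldots,x_n\in\mathbb{C}$ such that $f_i(x_i)=0$ and $f_j(x_i)\neq 0$ for all $1\leqslant i,j\leqslant n$ with $j\neq i$, and moreover $f_i(0)\neq 0$ for $i=1,\ldots,n$. -}

module Defs where

open import Algebra.Bundles.Raw using (RawRing)
open import Data.Integer.Base as ℤ using (+_)
import Data.Integer.Properties as ℤ
open import Data.List.Base using (List; []; _∷_; length)
open import Data.List.Relation.Unary.All using (All)
open import Data.List.Relation.Unary.AllPairs using (AllPairs)
open import Data.List.Relation.Unary.Any using (Any)
open import Data.Nat.Base as ℕ using (ℕ; zero; suc; NonZero; _⊔_)
import Data.Nat.Properties as ℕ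
open import Algebra.Properties.CommutativeSemigroup ℕ.*-commutativeSemigroup using (interchange)
open import Data.Product using (∃; _×_; _,_)
open import Data.Rational.Base as ℚ using (ℚ; mkℚ; 0ℚ; 1ℚ; ½; Positive)
import Data.Rational.Properties as ℚ
open import Data.Rational.Solver using (module +-*-Solver)
open import Data.Rational.Unnormalised.Base as ℚᵘ using (mkℚᵘ; *<*; *≤*)
import Data.Rational.Unnormalised.Properties as ℚᵘ
open import Data.Sum.Base using (inj₁; inj₂)
open import Data.Vec.Functional using (Vector)
open import Level using (0ℓ)
open import Relation.Binary.PropositionalEquality
  using (_≡_; _≢_; refl; sym; trans; cong; subst; subst₂)
open import Relation.Nullary using (¬_; yes; no)
open import Relation.Unary using (Pred)

IsCauchy : (ℕ → ℚ) → Set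
IsCauchy x = ∀ ε → 0ℚ ℚ.< ε → ∃ λ N → ∀ m n → N ℕ.≤ m → N ℕ.≤ n → ℚ.∣ x m ℚ.- x n ∣ ℚ.< ε

private
  split : ∀ a b c d → (a ℚ.+ b) ℚ.- (c ℚ.+ d) ≡ (a ℚ.- c) ℚ.+ (b ℚ.- d)
  split = solve 4 (λ a b c d → (a :+ b) :- (c :+ d) := (a :- c) :+ (b :- d)) refl
    where open +-*-Solver

  split* : ∀ a b c d → (a ℚ.* b) ℚ.- (c ℚ.* d) ≡ a ℚ.* (b ℚ.- d) ℚ.+ (a ℚ.- c) ℚ.* d
  split* = solve 4 (λ a b c d → (a :* b) :- (c :* d) := a :* (b :- d) :+ (a :- c) :* d) refl
    where open +-*-Solver

  neg-sub : ∀ a b → (ℚ.- a) ℚ.- (ℚ.- b) ≡ ℚ.- (a ℚ.- b)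
  neg-sub = solve 2 (λ a b → (:- a) :- (:- b) := :- (a :- b)) refl
    where open +-*-Solver

  add-sub : ∀ a b → a ≡ b ℚ.+ (a ℚ.- b)
  add-sub = solve 2 (λ a b → a := b :+ (a :- b)) refl
    where open +-*-Solver

  add-sub′ : ∀ a b → (b ℚ.+ a) ℚ.- b ≡ a
  add-sub′ = solve 2 (λ a b → (b :+ a) :- b := a) refl
    where open +-*-Solver

  sub-swap : ∀ a b → ℚ.- (a ℚ.- b) ≡ b ℚ.- a
  sub-swap = solve 2 (λ a b → :- (a :- b) := b :- a) refl
    where open +-*-Solver

  half+half : ∀ ε → ε ℚ.* ½ ℚ.+ ε ℚ.* ½ ≡ ε
  half+half ε = trans (sym (ℚ.*-distribˡ-+ ε ½ ½)) (ℚ.*-identityʳ ε)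

  half-pos : ∀ {ε} → 0ℚ ℚ.< ε → 0ℚ ℚ.< ε ℚ.* ½
  half-pos {ε} p = subst (ℚ._< ε ℚ.* ½) (ℚ.*-zeroˡ ½) (ℚ.*-monoˡ-<-pos ½ p)

  const-cauchy : ∀ q → IsCauchy (λ _ → q)
  const-cauchy q ε ε>0 = 0 , λ _ _ _ _ → subst (ℚ._< ε) (sym (cong ℚ.∣_∣ (ℚ.+-inverseʳ q))) ε>0

  +-cauchy : ∀ x y → IsCauchy x → IsCauchy y → IsCauchy (λ n → x n ℚ.+ y n)
  +-cauchy x y cx cy ε ε>0 =
    let (M , hM) = cx _ (half-pos ε>0)
        (N , hN) = cy _ (half-pos ε>0)
    in M ⊔ N , λ m n p q → begin-strict
      ℚ.∣ (x m ℚ.+ y m) ℚ.- (x n ℚ.+ y n) ∣     ≡⟨ cong ℚ.∣_∣ (split (x m) (y m) (x n) (y n)) ⟩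
      ℚ.∣ (x m ℚ.- x n) ℚ.+ (y m ℚ.- y n) ∣     ≤⟨ ℚ.∣p+q∣≤∣p∣+∣q∣ (x m ℚ.- x n) (y m ℚ.- y n) ⟩
      ℚ.∣ x m ℚ.- x n ∣ ℚ.+ ℚ.∣ y m ℚ.- y n ∣   <⟨ ℚ.+-mono-< (hM m n (ℕ.m⊔n≤o⇒m≤o M N p) (ℕ.m⊔n≤o⇒m≤o M N q))
                                                             (hN m n (ℕ.m⊔n≤o⇒n≤o M N p) (ℕ.m⊔n≤o⇒n≤o M N q)) ⟩
      ε ℚ.* ½ ℚ.+ ε ℚ.* ½                       ≡⟨ half+half ε ⟩
      ε                                         ∎
    where open ℚ.≤-Reasoning

  neg-cauchy : ∀ x → IsCauchy x → IsCauchy (λ n → ℚ.- x n)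
  neg-cauchy x cx ε ε>0 =
    let (N , h) = cx ε ε>0
    in N , λ m n p q → subst (ℚ._< ε)
         (sym (trans (cong ℚ.∣_∣ (neg-sub (x m) (x n))) (ℚ.∣-p∣≡∣p∣ (x m ℚ.- x n))))
         (h m n p q)

  eventually-bounded : ∀ x → IsCauchy x →
    ∃ λ B → Positive B × ∃ λ N → ∀ n → N ℕ.≤ n → ℚ.∣ x n ∣ ℚ.≤ B
  eventually-bounded x cx =
    let (N , h) = cx 1ℚ (ℚ.positive⁻¹ 1ℚ)
    in ℚ.∣ x N ∣ ℚ.+ 1ℚ ,
       ℚ.positive (ℚ.+-mono-≤-< (ℚ.0≤∣p∣ (x N)) (ℚ.positive⁻¹ 1ℚ)) ,
       N , λ n p → begin
         ℚ.∣ x n ∣                           ≡⟨ cong ℚ.∣_∣ (add-sub (x n) (x N)) ⟩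
         ℚ.∣ x N ℚ.+ (x n ℚ.- x N) ∣         ≤⟨ ℚ.∣p+q∣≤∣p∣+∣q∣ (x N) (x n ℚ.- x N) ⟩
         ℚ.∣ x N ∣ ℚ.+ ℚ.∣ x n ℚ.- x N ∣     ≤⟨ ℚ.+-monoʳ-≤ ℚ.∣ x N ∣ (ℚ.<⇒≤ (h n N p ℕ.≤-refl)) ⟩
         ℚ.∣ x N ∣ ℚ.+ 1ℚ                    ∎
    where open ℚ.≤-Reasoning

  -- For B > 0 and ε > 0, a δ > 0 with B δ = ε.
  divide : ∀ B → Positive B → ∀ ε → 0ℚ ℚ.< ε → ∃ λ δ → 0ℚ ℚ.< δ × B ℚ.* δ ≡ ε
  divide B B>0 ε ε>0 = 1/B ℚ.* ε , ℚ.positive⁻¹ _ {{ℚ.pos*pos⇒pos 1/B {{ℚ.1/pos⇒pos B}} ε {{ℚ.positive ε>0}}}} ,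
      trans (sym (ℚ.*-assoc B 1/B ε)) (trans (cong (ℚ._* ε) (ℚ.*-inverseʳ B)) (ℚ.*-identityˡ ε))
    where
    instance
      B-pos : Positive B
      B-pos = B>0
      B-nz : ℚ.NonZero B
      B-nz = ℚ.pos⇒nonZero B
    1/B = ℚ.1/ B

  *-bound : ∀ {a b B δ} → Positive B → ℚ.∣ a ∣ ℚ.≤ B → ℚ.∣ b ∣ ℚ.< δ → ℚ.∣ a ℚ.* b ∣ ℚ.< B ℚ.* δ
  *-bound {a} {b} {B} {δ} B>0 a≤B b<δ = begin-strict
      ℚ.∣ a ℚ.* b ∣          ≡⟨ ℚ.∣p*q∣≡∣p∣*∣q∣ a b ⟩
      ℚ.∣ a ∣ ℚ.* ℚ.∣ b ∣    ≤⟨ ℚ.*-monoʳ-≤-nonNeg ℚ.∣ b ∣ {{ℚ.∣-∣-nonNeg b}} a≤B ⟩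
      B ℚ.* ℚ.∣ b ∣          <⟨ ℚ.*-monoʳ-<-pos B {{B>0}} b<δ ⟩
      B ℚ.* δ                ∎
    where open ℚ.≤-Reasoning

  *-cauchy : ∀ x y → IsCauchy x → IsCauchy y → IsCauchy (λ n → x n ℚ.* y n)
  *-cauchy x y cx cy ε ε>0 =
    let (A , A>0 , K , hA)  = eventually-bounded x cx
        (B , B>0 , L , hB)  = eventually-bounded y cy
        (δ , δ>0 , eq)      = divide (A ℚ.+ B) (ℚ.pos+pos⇒pos A {{A>0}} B {{B>0}}) ε ε>0
        (M , hM)            = cx δ δ>0
        (N , hN)            = cy δ δ>0
    in (K ⊔ L) ⊔ (M ⊔ N) , λ m n p q →
      let p₁ = ℕ.m⊔n≤o⇒m≤o (K ⊔ L) (M ⊔ N) p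
          p₂ = ℕ.m⊔n≤o⇒n≤o (K ⊔ L) (M ⊔ N) p
          q₁ = ℕ.m⊔n≤o⇒m≤o (K ⊔ L) (M ⊔ N) q
          q₂ = ℕ.m⊔n≤o⇒n≤o (K ⊔ L) (M ⊔ N) q
      in begin-strict
        ℚ.∣ x m ℚ.* y m ℚ.- x n ℚ.* y n ∣
          ≡⟨ cong ℚ.∣_∣ (split* (x m) (y m) (x n) (y n)) ⟩
        ℚ.∣ x m ℚ.* (y m ℚ.- y n) ℚ.+ (x m ℚ.- x n) ℚ.* y n ∣
          ≤⟨ ℚ.∣p+q∣≤∣p∣+∣q∣ (x m ℚ.* (y m ℚ.- y n)) ((x m ℚ.- x n) ℚ.* y n) ⟩
        ℚ.∣ x m ℚ.* (y m ℚ.- y n) ∣ ℚ.+ ℚ.∣ (x m ℚ.- x n) ℚ.* y n ∣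
          ≡⟨ cong (λ z → ℚ.∣ x m ℚ.* (y m ℚ.- y n) ∣ ℚ.+ ℚ.∣ z ∣) (ℚ.*-comm (x m ℚ.- x n) (y n)) ⟩
        ℚ.∣ x m ℚ.* (y m ℚ.- y n) ∣ ℚ.+ ℚ.∣ y n ℚ.* (x m ℚ.- x n) ∣
          <⟨ ℚ.+-mono-<
               (*-bound {x m} {y m ℚ.- y n} A>0 (hA m (ℕ.m⊔n≤o⇒m≤o K L p₁))
                 (hN m n (ℕ.m⊔n≤o⇒n≤o M N p₂) (ℕ.m⊔n≤o⇒n≤o M N q₂)))
               (*-bound {y n} {x m ℚ.- x n} B>0 (hB n (ℕ.m⊔n≤o⇒n≤o K L q₁))
                 (hM m n (ℕ.m⊔n≤o⇒m≤o M N p₂) (ℕ.m⊔n≤o⇒m≤o M N q₂))) ⟩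
        A ℚ.* δ ℚ.+ B ℚ.* δ
          ≡⟨ sym (ℚ.*-distribʳ-+ δ A B) ⟩
        (A ℚ.+ B) ℚ.* δ
          ≡⟨ eq ⟩
        ε ∎
    where open ℚ.≤-Reasoning

record ℝ : Set where
  constructor mkℝ
  field
    seq    : ℕ → ℚ
    cauchy : IsCauchy seq

open ℝ public

infix  4 _≈ℝ_ _<ℝ_ _≤ℝ_
infix  8 -ℝ_
infixl 7 _*ℝ_
infixl 6 _+ℝ_

_≈ℝ_ : ℝ → ℝ → Set
x ≈ℝ y = ∀ ε → 0ℚ ℚ.< ε → ∃ λ N → ∀ n → N ℕ.≤ n → ℚ.∣ seq x n ℚ.- seq y n ∣ ℚ.< ε

_<ℝ_ : ℝ → ℝ → Set
x <ℝ y = ∃ λ ε → 0ℚ ℚ.< ε × ∃ λ N → ∀ n → N ℕ.≤ n → seq x n ℚ.+ ε ℚ.≤ seq y n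

_≤ℝ_ : ℝ → ℝ → Set
x ≤ℝ y = ∀ ε → 0ℚ ℚ.< ε → ∃ λ N → ∀ n → N ℕ.≤ n → seq x n ℚ.≤ seq y n ℚ.+ ε

fromℚ : ℚ → ℝ
fromℚ q = mkℝ (λ _ → q) (const-cauchy q)

fromℕ : ℕ → ℝ
fromℕ n = fromℚ (+ n ℚ./ 1)

0ℝ 1ℝ : ℝ
0ℝ = fromℕ 0
1ℝ = fromℕ 1

_+ℝ_ _*ℝ_ : ℝ → ℝ → ℝ
x +ℝ y = mkℝ (λ n → seq x n ℚ.+ seq y n) (+-cauchy (seq x) (seq y) (cauchy x) (cauchy y))
x *ℝ y = mkℝ (λ n → seq x n ℚ.* seq y n) (*-cauchy (seq x) (seq y) (cauchy x) (cauchy y))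

-ℝ_ : ℝ → ℝ
-ℝ x = mkℝ (λ n → ℚ.- seq x n) (neg-cauchy (seq x) (cauchy x))

-- The largest b ≤ c with b ^ k ≤ a.
rootBelow : (k a c : ℕ) → ℕ
rootBelow k a zero = zero
rootBelow k a (suc c) with suc c ℕ.^ k ℕ.≤? a
... | yes _ = suc c
... | no  _ = rootBelow k a c

-- The integer part of the k-th root of a.
⌊root⌋ : (k a : ℕ) → ℕ
⌊root⌋ k a = rootBelow k a a

private
  rootBelow-lower : ∀ k .{{_ : NonZero k}} a c → rootBelow k a c ℕ.^ k ℕ.≤ a
  rootBelow-lower (suc k) a zero = ℕ.z≤n
  rootBelow-lower k a (suc c) with suc c ℕ.^ k ℕ.≤? a
  ... | yes p = p
  ... | no  _ = rootBelow-lower k a c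

  rootBelow-upper : ∀ k a c → a ℕ.< suc c ℕ.^ k → a ℕ.< suc (rootBelow k a c) ℕ.^ k
  rootBelow-upper k a zero    h = h
  rootBelow-upper k a (suc c) h with suc c ℕ.^ k ℕ.≤? a
  ... | yes _ = h
  ... | no ¬p = rootBelow-upper k a c (ℕ.≰⇒> ¬p)

  n≤n^k : ∀ k .{{_ : NonZero k}} n → suc n ℕ.≤ suc n ℕ.^ k
  n≤n^k (suc k) n = ℕ.m≤m*n (suc n) (suc n ℕ.^ k) {{ℕ.m^n≢0 (suc n) k}}

  ⌊root⌋-lower : ∀ k .{{_ : NonZero k}} a → ⌊root⌋ k a ℕ.^ k ℕ.≤ a
  ⌊root⌋-lower k a = rootBelow-lower k a a

  ⌊root⌋-upper : ∀ k .{{_ : NonZero k}} a → a ℕ.< suc (⌊root⌋ k a) ℕ.^ k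
  ⌊root⌋-upper k a = rootBelow-upper k a a (n≤n^k k a)

  ^-distribʳ-* : ∀ k m n → (m ℕ.* n) ℕ.^ k ≡ m ℕ.^ k ℕ.* n ℕ.^ k
  ^-distribʳ-* zero    m n = refl
  ^-distribʳ-* (suc k) m n =
    trans (cong (m ℕ.* n ℕ.*_) (^-distribʳ-* k m n)) (interchange m n (m ℕ.^ k) (n ℕ.^ k))

  /-mono-< : ∀ a b c d → a ℕ.* suc d ℕ.< c ℕ.* suc b → (+ a ℚ./ suc b) ℚ.< (+ c ℚ./ suc d)
  /-mono-< a b c d h = ℚ.toℚᵘ-cancel-<
    (ℚᵘ.<-respʳ-≃ (ℚᵘ.≃-sym (ℚ.toℚᵘ-fromℚᵘ (mkℚᵘ (+ c) d)))
      (ℚᵘ.<-respˡ-≃ (ℚᵘ.≃-sym (ℚ.toℚᵘ-fromℚᵘ (mkℚᵘ (+ a) b)))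
        (*<* (subst₂ ℤ._<_ (ℤ.pos-* a (suc d)) (ℤ.pos-* c (suc b)) (ℤ.+<+ h)))))

  /-mono-≤ : ∀ a b c d → a ℕ.* suc d ℕ.≤ c ℕ.* suc b → (+ a ℚ./ suc b) ℚ.≤ (+ c ℚ./ suc d)
  /-mono-≤ a b c d h = ℚ.toℚᵘ-cancel-≤
    (ℚᵘ.≤-respʳ-≃ (ℚᵘ.≃-sym (ℚ.toℚᵘ-fromℚᵘ (mkℚᵘ (+ c) d)))
      (ℚᵘ.≤-respˡ-≃ (ℚᵘ.≃-sym (ℚ.toℚᵘ-fromℚᵘ (mkℚᵘ (+ a) b)))
        (*≤* (subst₂ ℤ._≤_ (ℤ.pos-* a (suc d)) (ℤ.pos-* c (suc b)) (ℤ.+≤+ h)))))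

  /-suc : ∀ a d → (+ suc a ℚ./ suc d) ≡ (+ a ℚ./ suc d) ℚ.+ (+ 1 ℚ./ suc d)
  /-suc a d = ℚ.toℚᵘ-injective (ℚᵘ.≃-trans (ℚ.toℚᵘ-fromℚᵘ (mkℚᵘ (+ suc a) d))
      (ℚᵘ.≃-trans (ℚᵘ.*≡* eq)
        (ℚᵘ.≃-sym (ℚᵘ.≃-trans (ℚ.toℚᵘ-homo-+ (+ a ℚ./ suc d) (+ 1 ℚ./ suc d))
          (ℚᵘ.+-cong (ℚ.toℚᵘ-fromℚᵘ (mkℚᵘ (+ a) d)) (ℚ.toℚᵘ-fromℚᵘ (mkℚᵘ (+ 1) d)))))))
    where
    D = + suc d
    eq : + suc a ℤ.* (D ℤ.* D) ≡ (+ a ℤ.* D ℤ.+ + 1 ℤ.* D) ℤ.* D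
    eq = trans (sym (ℤ.*-assoc (+ suc a) D D)) (cong (ℤ._* D)
           (trans (cong (λ z → + z ℤ.* D) (ℕ.+-comm 1 a)) (ℤ.*-distribʳ-+ D (+ a) (+ 1))))

  archimedean : ∀ ε → 0ℚ ℚ.< ε → ∃ λ N → (+ 1 ℚ./ suc N) ℚ.≤ ε
  archimedean ε ε>0 with ℚ.positive ε>0
  archimedean ε@(mkℚ (+ suc a) d _) ε>0 | _ = d ,
    subst ((+ 1 ℚ./ suc d) ℚ.≤_) (ℚ.↥p/↧p≡p ε) (/-mono-≤ 1 d (suc a) d (ℕ.*-monoˡ-≤ (suc d) (ℕ.s≤s (ℕ.z≤n {a}))))

rootSeq : (k a : ℕ) → ℕ → ℚ
rootSeq k a j = + ⌊root⌋ k (a ℕ.* suc j ℕ.^ k) ℚ./ suc j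

private
  rootSeq-close : ∀ k .{{_ : NonZero k}} a i j → rootSeq k a i ℚ.< rootSeq k a j ℚ.+ (+ 1 ℚ./ suc j)
  rootSeq-close k a i j = subst (rootSeq k a i ℚ.<_) (/-suc q j) (/-mono-< p i (suc q) j (ℕ.≰⇒> λ h → ℕ.<⇒≱ lt (ℕ.^-monoˡ-≤ k h)))
    where
    i⁺ = suc i
    j⁺ = suc j
    p = ⌊root⌋ k (a ℕ.* i⁺ ℕ.^ k)
    q = ⌊root⌋ k (a ℕ.* j⁺ ℕ.^ k)
    lt : (p ℕ.* j⁺) ℕ.^ k ℕ.< (suc q ℕ.* i⁺) ℕ.^ k
    lt = begin-strict
        (p ℕ.* j⁺) ℕ.^ k                   ≡⟨ ^-distribʳ-* k p j⁺ ⟩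
        p ℕ.^ k ℕ.* j⁺ ℕ.^ k               ≤⟨ ℕ.*-monoˡ-≤ (j⁺ ℕ.^ k) (⌊root⌋-lower k (a ℕ.* i⁺ ℕ.^ k)) ⟩
        a ℕ.* i⁺ ℕ.^ k ℕ.* j⁺ ℕ.^ k         ≡⟨ ℕ.*-assoc a (i⁺ ℕ.^ k) (j⁺ ℕ.^ k) ⟩
        a ℕ.* (i⁺ ℕ.^ k ℕ.* j⁺ ℕ.^ k)       ≡⟨ cong (a ℕ.*_) (ℕ.*-comm (i⁺ ℕ.^ k) (j⁺ ℕ.^ k)) ⟩
        a ℕ.* (j⁺ ℕ.^ k ℕ.* i⁺ ℕ.^ k)       ≡⟨ ℕ.*-assoc a (j⁺ ℕ.^ k) (i⁺ ℕ.^ k) ⟨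
        a ℕ.* j⁺ ℕ.^ k ℕ.* i⁺ ℕ.^ k         <⟨ ℕ.*-monoˡ-< (i⁺ ℕ.^ k) {{ℕ.m^n≢0 i⁺ k}} (⌊root⌋-upper k (a ℕ.* j⁺ ℕ.^ k)) ⟩
        suc q ℕ.^ k ℕ.* i⁺ ℕ.^ k           ≡⟨ ^-distribʳ-* k (suc q) i⁺ ⟨
        (suc q ℕ.* i⁺) ℕ.^ k               ∎
      where open ℕ.≤-Reasoning

  rootSeq-diff : ∀ k .{{_ : NonZero k}} a ε N → (+ 1 ℚ./ suc N) ℚ.≤ ε → ∀ i j → N ℕ.≤ j →
    rootSeq k a i ℚ.- rootSeq k a j ℚ.< ε
  rootSeq-diff k a ε N h i j N≤j = begin-strict
      rootSeq k a i ℚ.- r                         <⟨ ℚ.+-monoˡ-< (ℚ.- r) (rootSeq-close k a i j) ⟩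
      (r ℚ.+ (+ 1 ℚ./ suc j)) ℚ.- r               ≡⟨ add-sub′ (+ 1 ℚ./ suc j) r ⟩
      + 1 ℚ./ suc j                               ≤⟨ /-mono-≤ 1 j 1 N (ℕ.*-monoʳ-≤ 1 (ℕ.s≤s N≤j)) ⟩
      + 1 ℚ./ suc N                               ≤⟨ h ⟩
      ε                                           ∎
    where
    open ℚ.≤-Reasoning
    r = rootSeq k a j

  root-cauchy : ∀ k .{{_ : NonZero k}} a → IsCauchy (rootSeq k a)
  root-cauchy k a ε ε>0 with archimedean ε ε>0
  ... | N , h = N , λ i j N≤i N≤j → abs< i j N≤i N≤j
    where
    abs< : ∀ i j → N ℕ.≤ i → N ℕ.≤ j → ℚ.∣ rootSeq k a i ℚ.- rootSeq k a j ∣ ℚ.< ε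
    abs< i j N≤i N≤j with ℚ.∣p∣≡p∨∣p∣≡-p (rootSeq k a i ℚ.- rootSeq k a j)
    ... | inj₁ e = subst (ℚ._< ε) (sym e) (rootSeq-diff k a ε N h i j N≤j)
    ... | inj₂ e = subst (ℚ._< ε) (sym (trans e (sub-swap (rootSeq k a i) (rootSeq k a j))))
                     (rootSeq-diff k a ε N h j i N≤i)

-- The k-th root of a, as the limit of ⌊root⌋ k (a (j+1)ᵏ) / (j+1), whose
-- distance from the root is less than 1/(j+1).
root : (k : ℕ) .{{_ : NonZero k}} → ℕ → ℝ
root k a = mkℝ (rootSeq k a) (root-cauchy k a)

infixr 8 _^[_/_]

-- The rational power a ^ (p / q).
_^[_/_] : (a p q : ℕ) .{{_ : NonZero q}} → ℝ
a ^[ p / q ] = root q (a ℕ.^ p)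

2n-nonZero : ∀ {n} → n ℕ.≥ 2 → NonZero (2 ℕ.* n)
2n-nonZero {n} h = ℕ.m*n≢0 2 n {{_}} {{ℕ.>-nonZero (ℕ.<-trans (ℕ.s≤s ℕ.z≤n) h)}}

infix 4 _≈_ _≉_

record ℂ : Set where
  constructor _+i_
  field
    re im : ℝ

open ℂ public

_≈_ _≉_ : ℂ → ℂ → Set
z ≈ w = (re z ≈ℝ re w) × (im z ≈ℝ im w)
z ≉ w = ¬ (z ≈ w)

ℂ-rawRing : RawRing 0ℓ 0ℓ
ℂ-rawRing = record
  { Carrier = ℂ
  ; _≈_ = _≈_
  ; _+_ = λ z w → (re z +ℝ re w) +i (im z +ℝ im w)
  ; _*_ = λ z w → (re z *ℝ re w +ℝ -ℝ (im z *ℝ im w)) +i (re z *ℝ im w +ℝ im z *ℝ re w)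
  ; -_  = λ z → (-ℝ re z) +i (-ℝ im z)
  ; 0#  = 0ℝ +i 0ℝ
  ; 1#  = 1ℝ +i 0ℝ
  }

open RawRing ℂ-rawRing public using (_+_; _*_; -_)
  renaming (0# to 0ℂ; 1# to 1ℂ)
open import Algebra.Definitions.RawSemiring (RawRing.rawSemiring ℂ-rawRing) public using (_^_)

-- Polynomials over ℂ as lists of coefficients, constant term first;
-- trailing zero coefficients are allowed.
ℂ[x] : Set
ℂ[x] = List ℂ

coeff : ℂ[x] → ℕ → ℂ
coeff []      _       = 0ℂ
coeff (a ∷ _) zero    = a
coeff (_ ∷ f) (suc k) = coeff f k

eval : ℂ[x] → ℂ → ℂ
eval []      x = 0ℂ
eval (a ∷ f) x = a + x * eval f x

HasDegree : ℂ[x] → ℕ → Set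
HasDegree f d = coeff f d ≉ 0ℂ × (∀ k → d ℕ.< k → coeff f k ≈ 0ℂ)

Admissible : ∀ {n} → Vector ℂ[x] n → Set
Admissible {n} f =
  (∃ λ (x : Vector ℂ n) →
    (∀ i → eval (f i) (x i) ≈ 0ℂ) ×
    (∀ i j → j ≢ i → eval (f j) (x i) ≉ 0ℂ)) ×
  (∀ i → eval (f i) 0ℂ ≉ 0ℂ)

μ : ℕ → Pred ℂ 0ℓ
μ t x = x ^ t ≈ 1ℂ

-- The coset g G, for g ≉ 0.
coset : ℂ → Pred ℂ 0ℓ → Pred ℂ 0ℓ
coset g G x = ∃ λ h → G h × x ≈ g * h

HasCardinality : Pred ℂ 0ℓ → ℕ → Set
HasCardinality P k = ∃ λ (xs : List ℂ) →
  length xs ≡ k × All P xs × AllPairs _≉_ xs × (∀ x → P x → Any (x ≈_) xs)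

-- P is finite with at most B elements. Stated through finite families of distinct
-- elements, since equality in ℂ is undecidable and an exact count of P
-- need not be computable.
CardinalityAtMost : Pred ℂ 0ℓ → ℝ → Set
CardinalityAtMost P B = ∀ (xs : List ℂ) → All P xs → AllPairs _≉_ xs → fromℕ (length xs) ≤ℝ B

{-# OPTIONS --safe #-}

-- Elements of G have modulus 1, so every x in M satisfies f₁(x) f̄₁(x̄) = |g₁|² and
-- f₂(x) f̄₂(x̄) = |g₂|². Eliminating w from f₁(z) f̄₁(w) = |g₁|² and f₂(z) f̄₂(w) = |g₂|²
-- gives a polynomial in z that vanishes on M and whose degree depends on m₁ and m₂ only. At a
-- root of f₁ which is not a root of f₂ the linear system for the powers of w is triangular
-- with nonzero diagonal, so this polynomial is not zero. Hence |M| is bounded by a constant.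

module Submission where

open import Algebra.Bundles using (CommutativeRing)
open import Algebra.Definitions
  using (Associative; Commutative; Congruent₂; LeftIdentity; _DistributesOverˡ_)
open import Algebra.Morphism.Structures using (IsRingHomomorphism)
open import Algebra.Structures using (IsCommutativeRing)
open import Data.Fin.Base as Fin using (Fin)
open import Data.Integer.Base as ℤ using (+_)
import Data.Integer.Properties as ℤ
open import Data.List.Base using (List; []; _∷_; length; map; replicate; _++_)
open import Data.List.Relation.Unary.All as All using (All; []; _∷_)
open import Data.List.Relation.Unary.AllPairs using (AllPairs; []; _∷_)
open import Data.List.Relation.Unary.Any using (Any)
open import Data.Maybe.Base using (nothing)
open import Data.Nat.Base as ℕ using (ℕ; zero; suc; z≤n; s≤s; NonZero; _>_; _≥_)
  renaming (_+_ to _+ₙ_; _*_ to _*ₙ_)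
import Data.Nat.Properties as ℕ
open import Data.Product using (∃; _×_; _,_; proj₁; proj₂)
open import Data.Rational.Base as ℚ using (ℚ; 0ℚ; 1ℚ; ½; Positive)
import Data.Rational.Properties as ℚ
open import Data.Rational.Solver using (module +-*-Solver)
import Data.Rational.Unnormalised.Base as ℚᵘ
import Data.Rational.Unnormalised.Properties as ℚᵘ
open import Data.Sum.Base using (inj₁; inj₂)
open import Data.Vec.Functional using (Vector)
open import Function.Base using (_∘_)
open import Level using (0ℓ; _⊔_)
open import Relation.Binary.Bundles using (Setoid)
open import Relation.Binary.PropositionalEquality as ≡ using (_≡_)
open import Relation.Binary.Structures using (IsEquivalence)
open import Relation.Nullary using (¬_; yes; no; contradiction)

-- Equality in ℂ is undecidable, so a proof cannot search for a nonzero pivot, test a leading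
-- coefficient, or split a vanishing product into two cases. Elimination therefore multiplies
-- crosswise with pivots in a fixed order and never divides. That the result vanishes on M holds
-- whatever the pivots are; they have to be nonzero only at the one root of f₁ where the matrix is
-- triangular. A polynomial with too many roots is shown to vanish everywhere, and evaluating it at
-- that root gives the contradiction. The algebra is done in a commutative ring where nonzero
-- factors cancel. Analysis enters only to prove this cancellation in ℂ and that elements of G have
-- modulus 1. Since 1 lies in G, |G| is at least 1, and so is every positive power of it; a constant
-- bound on |M| thus implies the stated one.

module Elimination {c ℓ} (R : CommutativeRing c ℓ) where
  open CommutativeRing R
  open import Algebra.Properties.Ring ring using
    ( +-cancelˡ; -‿distribˡ-*; -0#≈0#; -1*x≈-x; -‿involutive; +-inverseˡ-unique
    ; x≈y⇒x∙y⁻¹≈ε; x∙y⁻¹≈ε⇒x≈y)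
  open import Algebra.Properties.CommutativeSemigroup *-commutativeSemigroup using (x∙yz≈y∙xz; interchange)
  open import Algebra.Properties.CommutativeSemiring.Exp commutativeSemiring using (_^_; ^-distrib-*)
  open import Relation.Binary.Reasoning.Setoid setoid
  open import Tactic.RingSolver.Core.AlmostCommutativeRing using (fromCommutativeRing)
  open import Tactic.RingSolver.NonReflective (fromCommutativeRing R (λ _ → nothing))

  -- Polynomial functions of bounded degree

  -- Horner form, stated for functions up to `≈` rather than for coefficient lists: `eliminant` is
  -- built from ring operations on values and gets a degree bound without any arithmetic of
  -- polynomials. The top coefficient may be zero.
  Degree< : ℕ → (Carrier → Carrier) → Set (c ⊔ ℓ)
  Degree< zero    φ = ∀ x → φ x ≈ 0#
  Degree< (suc d) φ = ∃ λ a → ∃ λ ψ → Degree< d ψ × ∀ x → φ x ≈ a + x * ψ x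

  degree-cong : ∀ d {φ χ} → (∀ x → φ x ≈ χ x) → Degree< d φ → Degree< d χ
  degree-cong zero    eq h               = λ x → trans (sym (eq x)) (h x)
  degree-cong (suc d) eq (a , ψ , h , e) = a , ψ , h , λ x → trans (sym (eq x)) (e x)

  degree-0 : ∀ d → Degree< d (λ _ → 0#)
  degree-0 zero    = λ _ → refl
  degree-0 (suc d) = 0# , (λ _ → 0#) , degree-0 d , λ x → sym (trans (+-identityˡ _) (zeroʳ x))

  degree-mono : ∀ {d e φ} → d ℕ.≤ e → Degree< d φ → Degree< e φ
  degree-mono {e = e} z≤n h = degree-cong e (sym ∘ h) (degree-0 e)
  degree-mono (s≤s d≤e) (a , ψ , h , eq) = a , ψ , degree-mono d≤e h , eq

  degree-+ : ∀ d {φ χ} → Degree< d φ → Degree< d χ → Degree< d (λ x → φ x + χ x)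
  degree-+ zero    h k = λ x → trans (+-cong (h x) (k x)) (+-identityˡ 0#)
  degree-+ (suc d) (a , ψ , h , eq) (b , ω , k , eq′) = a + b , _ , degree-+ d h k , λ x →
    trans (+-cong (eq x) (eq′ x))
      (solve 5 (λ a b x y z → ((a ⊕ x ⊗ y) ⊕ (b ⊕ x ⊗ z)) ⊜ ((a ⊕ b) ⊕ x ⊗ (y ⊕ z))) refl a b x _ _)

  degree-scale : ∀ d b {φ} → Degree< d φ → Degree< d (λ x → b * φ x)
  degree-scale zero    b h               = λ x → trans (*-congˡ (h x)) (zeroʳ b)
  degree-scale (suc d) b (a , ψ , h , eq) = b * a , _ , degree-scale d b h , λ x →
    trans (*-congˡ (eq x)) (trans (distribˡ b a _) (+-congˡ (x∙yz≈y∙xz b x _)))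

  -- For positive `d` and `e` the sharp bound is `d + e - 1`; the slack avoids truncated subtraction
  -- and only enlarges the final constant.
  degree-* : ∀ d e {φ χ} → Degree< d φ → Degree< e χ → Degree< (d ℕ.+ e) (λ x → φ x * χ x)
  degree-* zero    e h k = degree-mono z≤n λ x → trans (*-congʳ (h x)) (zeroˡ _)
  degree-* (suc d) e {φ} {χ} (a , ψ , h , eq) k =
    degree-cong (suc d ℕ.+ e)
      (λ x → sym (trans (*-congʳ (eq x)) (trans (distribʳ _ a _) (+-congˡ (*-assoc x _ _)))))
      (degree-+ (suc d ℕ.+ e)
        (degree-mono (ℕ.m≤n+m e (suc d)) (degree-scale e a k))
        (0# , _ , degree-* d e h k , λ x → sym (+-identityˡ _)))

  degree-neg : ∀ d {φ} → Degree< d φ → Degree< d (λ x → - φ x)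
  degree-neg d h = degree-cong d (λ x → -1*x≈-x _) (degree-scale d (- 1#) h)

  degree-const : ∀ d a → Degree< (suc d) (λ _ → a)
  degree-const d a = a , _ , degree-0 d , λ x → sym (trans (+-congˡ (zeroʳ x)) (+-identityʳ a))

  -- Synthetic division. If ψ x = (x - y) ω x + ψ y, then a + x ψ x = (x - y) (ψ y + x ω x) + (a + y
  -- ψ y), so the new quotient has constant term `ψ y` and the remainder is again the value at `y`.
  quotient : ∀ d {φ} → Degree< (suc d) φ → ∀ y →
    ∃ λ ψ → Degree< d ψ × ∀ x → φ x ≈ (x - y) * ψ x + φ y
  quotient zero {φ} (a , ψ , h , eq) y = _ , degree-0 0 , λ x →
    trans (const x) (trans (sym (const y)) (sym (trans (+-congʳ (zeroʳ _)) (+-identityˡ _))))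
    where
    const : ∀ x → φ x ≈ a
    const x = trans (eq x) (trans (+-congˡ (trans (*-congˡ (h x)) (zeroʳ x))) (+-identityʳ a))
  quotient (suc d) {φ} (a , ψ , h , eq) y with quotient d h y
  ... | ω , k , eq′ = _ , (ψ y , ω , k , λ x → refl) , λ x → begin
    φ x                                                   ≈⟨ eq x ⟩
    a + x * ψ x                                           ≈⟨ +-congˡ (*-congˡ (eq′ x)) ⟩
    a + x * ((x - y) * ω x + ψ y)                         ≈⟨ +-congˡ (distribˡ x _ _) ⟩
    a + (x * ((x - y) * ω x) + x * ψ y)                   ≈⟨ +-congˡ (+-congˡ (*-congʳ (restore x))) ⟨
    a + (x * ((x - y) * ω x) + ((x - y) + y) * ψ y)       ≈⟨ regroup a x y (x - y) (ω x) (ψ y) ⟩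
    (x - y) * (ψ y + x * ω x) + (a + y * ψ y)             ≈⟨ +-congˡ (eq y) ⟨
    (x - y) * (ψ y + x * ω x) + φ y                       ∎
    where
    restore : ∀ x → (x - y) + y ≈ x
    restore x = trans (+-assoc x _ y) (trans (+-congˡ (-‿inverseˡ y)) (+-identityʳ x))
    regroup : ∀ a x y d q r → a + (x * (d * q) + (d + y) * r) ≈ d * (r + x * q) + (a + y * r)
    regroup = solve 6 (λ a x y d q r →
      (a ⊕ (x ⊗ (d ⊗ q) ⊕ (d ⊕ y) ⊗ r)) ⊜ (d ⊗ (r ⊕ x ⊗ q) ⊕ (a ⊕ y ⊗ r))) refl

  -- The constructive form: which of two factors of a zero product vanishes cannot be decided in ℂ,
  -- but a factor known to be nonzero can be cancelled.
  NoZeroDivisors : Set (c ⊔ ℓ)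
  NoZeroDivisors = ∀ {x y} → x ≉ 0# → x * y ≈ 0# → y ≈ 0#

  -- Divide by `x - y` for the first root `y`: at every other root this factor is nonzero, so the
  -- quotient vanishes there and induction applies to it.
  many-roots⇒0 : NoZeroDivisors → ∀ d {φ} → Degree< d φ → ∀ xs → d ℕ.≤ length xs →
    All (λ x → φ x ≈ 0#) xs → AllPairs _≉_ xs → ∀ x → φ x ≈ 0#
  many-roots⇒0 nzd zero    h xs _ _ _ = h
  many-roots⇒0 nzd (suc d) {φ} h (y ∷ ys) (s≤s d≤) (φy≈0 ∷ roots) (y≉ ∷ distinct) x
    with quotient d h y
  ... | ψ , k , eq = trans (divided x)
      (trans (*-congˡ (many-roots⇒0 nzd d k ys d≤ ψ-roots distinct x)) (zeroʳ _))
    where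
    divided : ∀ x → φ x ≈ (x - y) * ψ x
    divided x = trans (eq x) (trans (+-congˡ φy≈0) (+-identityʳ _))
    ψ-roots : All (λ x → ψ x ≈ 0#) ys
    ψ-roots = All.zipWith
      (λ (y≉x , φx≈0) → nzd (λ x-y≈0 → y≉x (sym (x∙y⁻¹≈ε⇒x≈y _ _ x-y≈0)))
        (trans (sym (divided _)) φx≈0))
      (y≉ , roots)

  -- Elimination in linear systems

  Σ≤ : ℕ → (ℕ → Carrier) → Carrier
  Σ≤ zero    t = t 0
  Σ≤ (suc N) t = Σ≤ N t + t (suc N)

  Σ≤-cong : ∀ N {t u} → (∀ j → j ℕ.≤ N → t j ≈ u j) → Σ≤ N t ≈ Σ≤ N u
  Σ≤-cong zero    eq = eq 0 z≤n
  Σ≤-cong (suc N) eq = +-cong (Σ≤-cong N λ j j≤N → eq j (ℕ.m≤n⇒m≤1+n j≤N)) (eq (suc N) ℕ.≤-refl)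

  Σ≤-0 : ∀ N → Σ≤ N (λ _ → 0#) ≈ 0#
  Σ≤-0 zero    = refl
  Σ≤-0 (suc N) = trans (+-congʳ (Σ≤-0 N)) (+-identityˡ 0#)

  Σ≤-uncons : ∀ N t → Σ≤ (suc N) t ≈ t 0 + Σ≤ N (t ∘ suc)
  Σ≤-uncons zero    t = refl
  Σ≤-uncons (suc N) t = trans (+-congʳ (Σ≤-uncons N t)) (+-assoc _ _ _)

  Σ≤-combine : ∀ N a b t u → Σ≤ N (λ j → a * t j + b * u j) ≈ a * Σ≤ N t + b * Σ≤ N u
  Σ≤-combine zero    a b t u = refl
  Σ≤-combine (suc N) a b t u = trans (+-congʳ (Σ≤-combine N a b t u))
    (solve 6 (λ a b s r x y → ((a ⊗ s ⊕ b ⊗ r) ⊕ (a ⊗ x ⊕ b ⊗ y)) ⊜ (a ⊗ (s ⊕ x) ⊕ b ⊗ (r ⊕ y)))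
      refl a b _ _ _ _)

  Σ≤-scale : ∀ N a t → Σ≤ N (λ j → a * t j) ≈ a * Σ≤ N t
  Σ≤-scale zero    a t = refl
  Σ≤-scale (suc N) a t = trans (+-congʳ (Σ≤-scale N a t)) (sym (distribˡ a _ _))

  Matrix : Set c
  Matrix = ℕ → ℕ → Carrier

  reduce : ℕ → Matrix → Matrix
  reduce N M i j = M N N * M i j + - M i N * M N j

  -- Fraction-free elimination of the variables N, N − 1, …, 1 from the
  -- equations Σ≤ N (λ j → M i j * v j) ≈ 0#.
  eliminant : ℕ → Matrix → Carrier
  eliminant zero    M = M 0 0
  eliminant (suc N) M = eliminant N (reduce (suc N) M)

  -- Multiplying equation `i` by the pivot and subtracting `M i n` times equation `n` cancels `v n`,
  -- so `v` solves the reduced system. This is valid even where the pivot is zero.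
  eliminant-solution : ∀ N (M : Matrix) (v : ℕ → Carrier) →
    (∀ i → i ℕ.≤ N → Σ≤ N (λ j → M i j * v j) ≈ 0#) →
    eliminant N M * v 0 ≈ 0#
  eliminant-solution zero    M v sol = sol 0 z≤n
  eliminant-solution (suc N) M v sol = eliminant-solution N (reduce (suc N) M) v λ i i≤N → begin
      Σ≤ N (λ j → (p * M i j + - M i n * M n j) * v j)
        ≈⟨ Σ≤-cong N (λ j _ → expand p (M i j) (- M i n) (M n j) (v j)) ⟩
      Σ≤ N (λ j → p * (M i j * v j) + - M i n * (M n j * v j))
        ≈⟨ Σ≤-combine N p (- M i n) _ _ ⟩
      p * S i + - M i n * S n
        ≈⟨ +-congʳ (*-congˡ (+-inverseˡ-unique _ _ (sol i (ℕ.m≤n⇒m≤1+n i≤N)))) ⟩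
      p * - (M i n * v n) + - M i n * S n
        ≈⟨ +-congʳ (*-congˡ (-‿distribˡ-* _ _)) ⟩
      p * (- M i n * v n) + - M i n * S n
        ≈⟨ +-congʳ (x∙yz≈y∙xz p _ _) ⟩
      - M i n * (p * v n) + - M i n * S n
        ≈⟨ distribˡ _ _ _ ⟨
      - M i n * (p * v n + S n)
        ≈⟨ *-congˡ (trans (+-comm _ _) (sol n ℕ.≤-refl)) ⟩
      - M i n * 0#
        ≈⟨ zeroʳ _ ⟩
      0# ∎
    where
    n = suc N
    p = M n n
    S : ℕ → Carrier
    S i = Σ≤ N (λ j → M i j * v j)
    expand : ∀ p a m b x → (p * a + m * b) * x ≈ p * (a * x) + m * (b * x)
    expand p a m b x = trans (distribʳ x _ _) (+-cong (*-assoc p a x) (*-assoc m b x))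

  -- When the last column vanishes above the diagonal, `reduce` merely scales the remaining rows by
  -- the nonzero pivot, so the shape and the nonzero diagonal persist.
  eliminant-triangular : NoZeroDivisors → ∀ N (M : Matrix) →
    (∀ i j → i ℕ.< j → j ℕ.≤ N → M i j ≈ 0#) →
    (∀ i → i ℕ.≤ N → M i i ≉ 0#) → eliminant N M ≉ 0#
  eliminant-triangular nzd zero    M upper diagonal = diagonal 0 z≤n
  eliminant-triangular nzd (suc N) M upper diagonal = eliminant-triangular nzd N (reduce n M)
      (λ i j i<j j≤N → trans (reduced i j (ℕ.≤-trans (ℕ.<⇒≤ i<j) j≤N))
        (trans (*-congˡ (upper i j i<j (ℕ.m≤n⇒m≤1+n j≤N))) (zeroʳ _)))
      (λ i i≤N eq → diagonal i (ℕ.m≤n⇒m≤1+n i≤N)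
        (nzd (diagonal n ℕ.≤-refl) (trans (sym (reduced i i i≤N)) eq)))
    where
    n = suc N
    reduced : ∀ i j → i ℕ.≤ N → reduce n M i j ≈ M n n * M i j
    reduced i j i≤N = begin
      M n n * M i j + - M i n * M n j    ≈⟨ +-congˡ (*-congʳ (-‿cong (upper i n (s≤s i≤N) ℕ.≤-refl))) ⟩
      M n n * M i j + - 0# * M n j       ≈⟨ +-congˡ (trans (*-congʳ -0#≈0#) (zeroˡ _)) ⟩
      M n n * M i j + 0#                 ≈⟨ +-identityʳ _ ⟩
      M n n * M i j                      ∎

  -- Entries of `reduce` are quadratic in the old entries, so each of the `N` steps doubles the
  -- bound. A determinant would give a bound linear in `N`, but only independence of `z` and of the
  -- group matters here.
  eliminant-degree : ∀ N d (M : Carrier → Matrix) →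
    (∀ i j → i ℕ.≤ N → j ℕ.≤ N → Degree< d (λ z → M z i j)) →
    Degree< (2 ℕ.^ N ℕ.* d) (λ z → eliminant N (M z))
  eliminant-degree zero    d M h =
    ≡.subst (λ e → Degree< e (λ z → M z 0 0)) (≡.sym (ℕ.+-identityʳ d)) (h 0 0 z≤n z≤n)
  eliminant-degree (suc N) d M h = ≡.subst (λ e → Degree< e (λ z → eliminant (suc N) (M z)))
    (≡.trans (≡.cong (λ e → 2 ℕ.^ N ℕ.* (d ℕ.+ e)) (≡.sym (ℕ.+-identityʳ d)))
      (≡.trans (≡.sym (ℕ.*-assoc (2 ℕ.^ N) 2 d)) (≡.cong (ℕ._* d) (ℕ.*-comm (2 ℕ.^ N) 2))))
    (eliminant-degree N (d ℕ.+ d) (λ z → reduce n (M z)) λ i j i≤N j≤N →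
      let i≤n = ℕ.m≤n⇒m≤1+n i≤N
          j≤n = ℕ.m≤n⇒m≤1+n j≤N
      in degree-+ (d ℕ.+ d) (degree-* d d (h n n ℕ.≤-refl ℕ.≤-refl) (h i j i≤n j≤n))
           (degree-* d d (degree-neg d (h i n i≤n ℕ.≤-refl)) (h n j ℕ.≤-refl j≤n)))
    where n = suc N

  -- Two polynomial equations in two separated variables

  coeff : List Carrier → ℕ → Carrier
  coeff []      _       = 0#
  coeff (a ∷ _) zero    = a
  coeff (_ ∷ f) (suc k) = coeff f k

  eval : List Carrier → Carrier → Carrier
  eval []      x = 0#
  eval (a ∷ f) x = a + x * eval f x

  -- A condition on coefficients, not on the list: trailing entries can be zero up to `≈` without
  -- being removable.
  HasLength≤ : ℕ → List Carrier → Set ℓ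
  HasLength≤ d f = ∀ k → d ℕ.≤ k → coeff f k ≈ 0#

  eval-0 : ∀ f → HasLength≤ 0 f → ∀ x → eval f x ≈ 0#
  eval-0 []      h x = refl
  eval-0 (a ∷ f) h x = trans
    (+-cong (h 0 z≤n) (trans (*-congˡ (eval-0 f (λ k _ → h (suc k) z≤n) x)) (zeroʳ x)))
    (+-identityˡ 0#)

  eval-degree : ∀ d f → HasLength≤ d f → Degree< d (eval f)
  eval-degree zero    f       h = eval-0 f h
  eval-degree (suc d) []      h = degree-0 (suc d)
  eval-degree (suc d) (a ∷ f) h = a , _ , eval-degree d f (λ k d≤k → h (suc k) (s≤s d≤k)) , λ x → refl

  eval≈Σ≤ : ∀ N f → HasLength≤ (suc N) f → ∀ x → Σ≤ N (λ j → coeff f j * x ^ j) ≈ eval f x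
  eval≈Σ≤ N [] h x = trans (Σ≤-cong N (λ j _ → zeroˡ _)) (Σ≤-0 N)
  eval≈Σ≤ zero (a ∷ f) h x = trans (*-identityʳ a)
    (sym (trans (+-congˡ (trans (*-congˡ (eval-0 f (λ k _ → h (suc k) (s≤s z≤n)) x)) (zeroʳ x)))
      (+-identityʳ a)))
  eval≈Σ≤ (suc N) (a ∷ f) h x = begin
    Σ≤ (suc N) (λ j → coeff (a ∷ f) j * x ^ j)
      ≈⟨ Σ≤-uncons N _ ⟩
    a * 1# + Σ≤ N (λ j → coeff f j * (x * x ^ j))
      ≈⟨ +-cong (*-identityʳ a) (Σ≤-cong N (λ j _ → x∙yz≈y∙xz _ x _)) ⟩
    a + Σ≤ N (λ j → x * (coeff f j * x ^ j))
      ≈⟨ +-congˡ (Σ≤-scale N x _) ⟩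
    a + x * Σ≤ N (λ j → coeff f j * x ^ j)
      ≈⟨ +-congˡ (*-congˡ (eval≈Σ≤ N f (λ k p → h (suc k) (s≤s p)) x)) ⟩
    a + x * eval f x ∎

  shift : ℕ → List Carrier → List Carrier
  shift k f = replicate k 0# ++ f

  eval-shift : ∀ k f x → eval (shift k f) x ≈ x ^ k * eval f x
  eval-shift zero    f x = sym (*-identityˡ _)
  eval-shift (suc k) f x = trans (+-identityˡ _) (trans (*-congˡ (eval-shift k f x)) (sym (*-assoc x _ _)))

  coeff-shift : ∀ k f {i} j → k ℕ.+ j ≡ i → coeff (shift k f) i ≡ coeff f j
  coeff-shift zero    f j ≡.refl = ≡.refl
  coeff-shift (suc k) f j ≡.refl = coeff-shift k f j ≡.refl

  shift-length : ∀ k d f → HasLength≤ d f → HasLength≤ (k ℕ.+ d) (shift k f)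
  shift-length zero    d f h = h
  shift-length (suc k) d f h (suc j) (s≤s p) = shift-length k d f h j p

  singleton-length : ∀ r → HasLength≤ 1 (r ∷ [])
  singleton-length r (suc k) _ = refl

  length-mono : ∀ {d e} f → d ℕ.≤ e → HasLength≤ d f → HasLength≤ e f
  length-mono f d≤e h k e≤k = h k (ℕ.≤-trans d≤e e≤k)

  -- The coefficients, as a polynomial in w, of w ^ k * (eval f z * eval e w - r).
  row : (f e : List Carrier) (r : Carrier) (k : ℕ) → Carrier → ℕ → Carrier
  row f e r k z j = eval f z * coeff (shift k e) j + - 1# * coeff (shift k (r ∷ [])) j

  -- The sum is w ^ k (f(z) e(w) - r), which is zero. The hypothesis `k + d ≤ N` makes the product
  -- with w ^ k fit into the columns 0, ..., `N`.
  row-solution : ∀ {N d} f e r k → HasLength≤ (suc d) e → k ℕ.+ d ℕ.≤ N → ∀ z w →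
    eval f z * eval e w ≈ r → Σ≤ N (λ j → row f e r k z j * w ^ j) ≈ 0#
  row-solution {N} {d} f e r k h k+d≤N z w eq = begin
    Σ≤ N (λ j → row f e r k z j * w ^ j)
      ≈⟨ Σ≤-cong N (λ j _ → trans (distribʳ _ _ _) (+-cong (*-assoc _ _ _) (*-assoc _ _ _))) ⟩
    Σ≤ N (λ j → eval f z * (coeff (shift k e) j * w ^ j) + - 1# * (coeff (shift k (r ∷ [])) j * w ^ j))
      ≈⟨ Σ≤-combine N (eval f z) (- 1#) _ _ ⟩
    eval f z * Σ≤ N (λ j → coeff (shift k e) j * w ^ j)
      + - 1# * Σ≤ N (λ j → coeff (shift k (r ∷ [])) j * w ^ j)
      ≈⟨ +-cong (*-congˡ (shifted e d h k+d≤N))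
           (*-congˡ (shifted (r ∷ []) 0 (singleton-length r) (ℕ.≤-trans (ℕ.+-monoʳ-≤ k z≤n) k+d≤N))) ⟩
    eval f z * (w ^ k * eval e w) + - 1# * (w ^ k * eval (r ∷ []) w)
      ≈⟨ +-cong (x∙yz≈y∙xz _ _ _) (-1*x≈-x _) ⟩
    w ^ k * (eval f z * eval e w) - w ^ k * eval (r ∷ []) w
      ≈⟨ x≈y⇒x∙y⁻¹≈ε (*-congˡ (trans eq (sym (trans (+-congˡ (zeroʳ w)) (+-identityʳ r))))) ⟩
    0# ∎
    where
    shifted : ∀ a c → HasLength≤ (suc c) a → k ℕ.+ c ℕ.≤ N →
      Σ≤ N (λ j → coeff (shift k a) j * w ^ j) ≈ w ^ k * eval a w
    shifted a c ha k+c≤N = trans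
      (eval≈Σ≤ N (shift k a) (length-mono (shift k a)
        (ℕ.≤-trans (ℕ.≤-reflexive (ℕ.+-suc k c)) (s≤s k+c≤N)) (shift-length k (suc c) a ha)) w)
      (eval-shift k a w)

  row-degree : ∀ {d e′} f e r k → HasLength≤ (suc d) f → d ℕ.≤ e′ →
    ∀ j → Degree< (suc e′) (λ z → row f e r k z j)
  row-degree {d} {e′} f e r k h d≤e′ j = degree-+ (suc e′)
    (degree-cong (suc e′) (λ z → *-comm _ _)
      (degree-scale (suc e′) (coeff (shift k e) j)
        (eval-degree (suc e′) f (length-mono f (s≤s d≤e′) h))))
    (degree-const e′ _)

  -- The Sylvester matrix in w of f₁(z) e₁(w) - r₁ and f₂(z) e₂(w) - r₂, of degrees at most `d₁` and
  -- `d₂` in w: `d₂` shifts of the first and `d₁` shifts of the second, hence `d₁ + d₂` rows and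
  -- columns, indexed by 0, ..., `N`. Degrees are given as successors so that `N` needs no
  -- subtraction.
  module Sylvester (m₁ m₂ : ℕ)
    (f₁ f₂ e₁ e₂ : List Carrier) (r₁ r₂ : Carrier)
    (length-f₁ : HasLength≤ (2 ℕ.+ m₁) f₁) (length-f₂ : HasLength≤ (2 ℕ.+ m₂) f₂)
    (length-e₁ : HasLength≤ (2 ℕ.+ m₁) e₁) (length-e₂ : HasLength≤ (2 ℕ.+ m₂) e₂)
    where

    d₁ d₂ N : ℕ
    d₁ = suc m₁
    d₂ = suc m₂
    N  = m₁ ℕ.+ d₂

    matrix : Carrier → Matrix
    matrix z i with i ℕ.<? d₂
    ... | yes _ = row f₁ e₁ r₁ i z
    ... | no  _ = row f₂ e₂ r₂ (i ℕ.∸ d₂) z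

    -- The classical resultant up to extra factors, which are products of pivots left in by
    -- elimination without division.
    resultant : Carrier → Carrier
    resultant z = eliminant N (matrix z)

    degreeBound : ℕ
    degreeBound = 2 ℕ.^ N ℕ.* suc (d₁ ℕ.+ d₂)

    resultant-degree : Degree< degreeBound resultant
    resultant-degree = eliminant-degree N _ matrix λ i j _ _ → degree i j
      where
      degree : ∀ i j → Degree< (suc (d₁ ℕ.+ d₂)) (λ z → matrix z i j)
      degree i j with i ℕ.<? d₂
      ... | yes _ = row-degree f₁ e₁ r₁ i length-f₁ (ℕ.m≤m+n d₁ d₂) j
      ... | no  _ = row-degree f₂ e₂ r₂ (i ℕ.∸ d₂) length-f₂ (ℕ.m≤n+m d₂ d₁) j

    resultant-commonZero : ∀ z w → eval f₁ z * eval e₁ w ≈ r₁ → eval f₂ z * eval e₂ w ≈ r₂ →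
      resultant z ≈ 0#
    resultant-commonZero z w eq₁ eq₂ =
      -- The solution vector consists of the powers of `w`. Its entry of index 0 is 1, so the
      -- product that vanishes is the resultant itself.
      trans (sym (*-identityʳ _)) (eliminant-solution N (matrix z) (w ^_) solution)
      where
      solution : ∀ i → i ℕ.≤ N → Σ≤ N (λ j → matrix z i j * w ^ j) ≈ 0#
      solution i i≤N with i ℕ.<? d₂
      ... | yes (s≤s i≤m₂) = row-solution f₁ e₁ r₁ i length-e₁
              (ℕ.≤-trans (ℕ.+-monoˡ-≤ d₁ i≤m₂)
                (ℕ.≤-reflexive (≡.trans (ℕ.+-comm m₂ d₁) (≡.sym (ℕ.+-suc m₁ m₂))))) z w eq₁
      ... | no i≮d₂        = row-solution f₂ e₂ r₂ (i ℕ.∸ d₂) length-e₂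
              (ℕ.≤-trans (ℕ.≤-reflexive (ℕ.m∸n+n≡m (ℕ.≮⇒≥ i≮d₂))) i≤N) z w eq₂

    -- Where f₁ vanishes, the first d₂ rows are − r₁ times the identity and the
    -- others have the leading coefficient of f₂(z) e₂ on the diagonal.
    resultant-≉0 : NoZeroDivisors → ∀ {x} → eval f₁ x ≈ 0# → eval f₂ x ≉ 0# →
      r₁ ≉ 0# → coeff e₂ d₂ ≉ 0# → resultant x ≉ 0#
    resultant-≉0 nzd {x} f₁x≈0 f₂x≉0 r₁≉0 lc≉0 = eliminant-triangular nzd N (matrix x)
        (λ i j i<j _ → upper i j i<j) (λ i _ → diagonal i)
      where
      combination-0 : ∀ {a b u v} → u ≈ 0# → v ≈ 0# → a * u + b * v ≈ 0#
      combination-0 u≈0 v≈0 = trans (+-cong (trans (*-congˡ u≈0) (zeroʳ _)) (trans (*-congˡ v≈0) (zeroʳ _)))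
        (+-identityˡ 0#)
      beyond : ∀ k r j → k ℕ.< j → coeff (shift k (r ∷ [])) j ≈ 0#
      beyond k r j k<j = shift-length k 1 (r ∷ []) (singleton-length r) j
        (ℕ.≤-trans (ℕ.≤-reflexive (ℕ.+-comm k 1)) k<j)
      upper : ∀ i j → i ℕ.< j → matrix x i j ≈ 0#
      upper i j i<j with i ℕ.<? d₂
      ... | yes _ = trans
            (+-cong (trans (*-congʳ f₁x≈0) (zeroˡ _)) (trans (*-congˡ (beyond i r₁ j i<j)) (zeroʳ _)))
            (+-identityˡ 0#)
      ... | no i≮d₂ = combination-0
            (shift-length (i ℕ.∸ d₂) (suc d₂) e₂ length-e₂ j
              (ℕ.≤-trans (ℕ.≤-reflexive
                (≡.trans (ℕ.+-suc _ d₂) (≡.cong suc (ℕ.m∸n+n≡m (ℕ.≮⇒≥ i≮d₂))))) i<j))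
            (beyond (i ℕ.∸ d₂) r₂ j (ℕ.≤-<-trans (ℕ.m∸n≤m i d₂) i<j))
      diagonal : ∀ i → matrix x i i ≉ 0#
      diagonal i eq with i ℕ.<? d₂
      ... | yes _ = r₁≉0 (begin
            r₁                                      ≡⟨ coeff-shift i (r₁ ∷ []) 0 (ℕ.+-identityʳ i) ⟨
            coeff (shift i (r₁ ∷ [])) i             ≈⟨ -‿involutive _ ⟨
            - - coeff (shift i (r₁ ∷ [])) i         ≈⟨ -‿cong (-1*x≈-x _) ⟨
            - (- 1# * coeff (shift i (r₁ ∷ [])) i)  ≈⟨ -‿cong (trans (+-congʳ f₁x*y≈0) (+-identityˡ _)) ⟨
            - row f₁ e₁ r₁ i x i                    ≈⟨ -‿cong eq ⟩
            - 0#                                    ≈⟨ -0#≈0# ⟩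
            0#                                      ∎)
        where
        f₁x*y≈0 : ∀ {y} → eval f₁ x * y ≈ 0#
        f₁x*y≈0 = trans (*-congʳ f₁x≈0) (zeroˡ _)
      ... | no i≮d₂ = lc≉0 (nzd f₂x≉0 (begin
            eval f₂ x * coeff e₂ d₂
              ≡⟨ ≡.cong (eval f₂ x *_) (coeff-shift (i ℕ.∸ d₂) e₂ d₂ split) ⟨
            eval f₂ x * coeff (shift (i ℕ.∸ d₂) e₂) i
              ≈⟨ +-identityʳ _ ⟨
            eval f₂ x * coeff (shift (i ℕ.∸ d₂) e₂) i + 0#
              ≈⟨ +-congˡ (trans (*-congˡ (beyond (i ℕ.∸ d₂) r₂ i k<i)) (zeroʳ _)) ⟨
            row f₂ e₂ r₂ (i ℕ.∸ d₂) x i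
              ≈⟨ eq ⟩
            0# ∎))
        where
        split : i ℕ.∸ d₂ ℕ.+ d₂ ≡ i
        split = ℕ.m∸n+n≡m (ℕ.≮⇒≥ i≮d₂)
        -- As `d₂` is positive, the entry coming from `r₂` lies strictly left of the diagonal.
        k<i : i ℕ.∸ d₂ ℕ.< i
        k<i = ≡.subst (i ℕ.∸ d₂ ℕ.<_) split (ℕ.m<m+n (i ℕ.∸ d₂) (s≤s z≤n))

    -- With `degreeBound` or more common zeros the resultant would vanish identically, contrary to
    -- its value at `x`.
    fewCommonZeros : NoZeroDivisors → ∀ {x} → eval f₁ x ≈ 0# → eval f₂ x ≉ 0# →
      r₁ ≉ 0# → coeff e₂ d₂ ≉ 0# → ∀ zs → AllPairs _≉_ zs →
      All (λ z → ∃ λ w → eval f₁ z * eval e₁ w ≈ r₁ × eval f₂ z * eval e₂ w ≈ r₂) zs →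
      length zs ℕ.< degreeBound
    fewCommonZeros nzd f₁x≈0 f₂x≉0 r₁≉0 lc≉0 zs distinct common = ℕ.≰⇒> λ many →
      resultant-≉0 nzd f₁x≈0 f₂x≉0 r₁≉0 lc≉0 (many-roots⇒0 nzd degreeBound resultant-degree zs many
        (All.map (λ (w , eq₁ , eq₂) → resultant-commonZero _ w eq₁ eq₂) common) distinct _)

  -- Roots of unity and conjugation

  1^k≈1 : ∀ k → 1# ^ k ≈ 1#
  1^k≈1 zero    = refl
  1^k≈1 (suc k) = trans (*-identityˡ _) (1^k≈1 k)

  -- In Horner form the sum is visibly 1 plus a product, the shape that `1+nonNegReal≉0` later shows
  -- to be nonzero.
  geometricSum : Carrier → ℕ → Carrier
  geometricSum x zero    = 0#
  geometricSum x (suc k) = 1# + x * geometricSum x k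

  geometric : ∀ x k → x ^ k ≈ 1# + geometricSum x k * (x - 1#)
  geometric x zero    = sym (trans (+-congˡ (zeroˡ _)) (+-identityʳ 1#))
  geometric x (suc k) = begin
    x * x ^ k                                        ≈⟨ *-congˡ (geometric x k) ⟩
    x * (1# + s * d)                                 ≈⟨ trans (distribˡ _ _ _) (+-congʳ (*-identityʳ x)) ⟩
    x + x * (s * d)                                  ≈⟨ +-cong restore (*-assoc x s d) ⟨
    (1# + d) + (x * s) * d                           ≈⟨ +-assoc _ _ _ ⟩
    1# + (d + (x * s) * d)                           ≈⟨ +-congˡ (trans (distribʳ _ _ _) (+-congʳ (*-identityˡ d))) ⟨
    1# + (1# + x * s) * d                            ∎
    where
    s = geometricSum x k
    d = x - 1#
    restore : 1# + d ≈ x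
    restore = trans (+-comm 1# d) (trans (+-assoc x _ _) (trans (+-congˡ (-‿inverseˡ 1#)) (+-identityʳ x)))

  rootOfUnity≈1 : NoZeroDivisors → ∀ k {x} → geometricSum x k ≉ 0# → x ^ k ≈ 1# → x ≈ 1#
  rootOfUnity≈1 nzd k {x} s≉0 eq = x∙y⁻¹≈ε⇒x≈y _ _ (nzd s≉0 (+-cancelˡ 1# _ _
    (trans (sym (geometric x k)) (trans eq (sym (+-identityʳ 1#))))))

  module Conjugation (conj : Carrier → Carrier) (isHom : IsRingHomomorphism rawRing rawRing conj) where
    open IsRingHomomorphism isHom using (⟦⟧-cong; +-homo; *-homo; 0#-homo; 1#-homo)

    coeff-conj : ∀ f k → coeff (map conj f) k ≈ conj (coeff f k)
    coeff-conj []      k       = sym 0#-homo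
    coeff-conj (a ∷ f) zero    = refl
    coeff-conj (a ∷ f) (suc k) = coeff-conj f k

    conj-length : ∀ d f → HasLength≤ d f → HasLength≤ d (map conj f)
    conj-length d f h k d≤k = trans (coeff-conj f k) (trans (⟦⟧-cong (h k d≤k)) 0#-homo)

    eval-conj : ∀ f x → eval (map conj f) (conj x) ≈ conj (eval f x)
    eval-conj []      x = sym 0#-homo
    eval-conj (a ∷ f) x = sym (trans (+-homo a _)
      (+-congˡ (trans (*-homo x _) (*-congˡ (sym (eval-conj f x))))))

    ^-homo : ∀ x k → conj (x ^ k) ≈ conj x ^ k
    ^-homo x zero    = 1#-homo
    ^-homo x (suc k) = trans (*-homo x _) (*-congˡ (^-homo x k))

    norm-^ : ∀ x k → x ^ k ≈ 1# → (x * conj x) ^ k ≈ 1#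
    norm-^ x k eq = begin
      (x * conj x) ^ k        ≈⟨ ^-distrib-* x (conj x) k ⟩
      x ^ k * conj x ^ k      ≈⟨ *-congˡ (^-homo x k) ⟨
      x ^ k * conj (x ^ k)    ≈⟨ *-cong eq (trans (⟦⟧-cong eq) 1#-homo) ⟩
      1# * 1#                 ≈⟨ *-identityˡ 1# ⟩
      1#                      ∎

    -- Multiplying by the conjugate removes the unknown group element `h`: membership in a coset
    -- becomes an algebraic equation in `x` and `conj x`.
    norm-eval : ∀ f {x g h} → eval f x ≈ g * h → h * conj h ≈ 1# →
      eval f x * eval (map conj f) (conj x) ≈ g * conj g
    norm-eval f {x} {g} {h} eq unit = begin
      eval f x * eval (map conj f) (conj x)    ≈⟨ *-congˡ (eval-conj f x) ⟩
      eval f x * conj (eval f x)               ≈⟨ *-cong eq (trans (⟦⟧-cong eq) (*-homo g h)) ⟩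
      (g * h) * (conj g * conj h)              ≈⟨ interchange g h (conj g) (conj h) ⟩
      (g * conj g) * (h * conj h)              ≈⟨ *-congˡ unit ⟩
      (g * conj g) * 1#                        ≈⟨ *-identityʳ _ ⟩
      g * conj g                               ∎

open import Defs
open ≡ using (refl; sym; trans; cong; cong₂; subst; subst₂)

-- Real and complex numbers

-- `x ≈ℝ y` unfolds to `Null` of the termwise difference, so the laws of `≈ℝ` reduce to closure
-- properties of null sequences and one rational identity each.
Null : (ℕ → ℚ) → Set
Null s = ∀ ε → 0ℚ ℚ.< ε → ∃ λ N → ∀ n → N ℕ.≤ n → ℚ.∣ s n ∣ ℚ.< ε

Bounded : (ℕ → ℚ) → Set
Bounded s = ∃ λ B → Positive B × ∃ λ N → ∀ n → N ℕ.≤ n → ℚ.∣ s n ∣ ℚ.≤ B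

half-pos : ∀ {ε} → 0ℚ ℚ.< ε → 0ℚ ℚ.< ε ℚ.* ½
half-pos {ε} p = subst (ℚ._< ε ℚ.* ½) (ℚ.*-zeroˡ ½) (ℚ.*-monoˡ-<-pos ½ p)

half+half : ∀ ε → ε ℚ.* ½ ℚ.+ ε ℚ.* ½ ≡ ε
half+half ε = trans (sym (ℚ.*-distribˡ-+ ε ½ ½)) (ℚ.*-identityʳ ε)

null-dominated : ∀ {s u} → (∀ n → ℚ.∣ u n ∣ ℚ.≤ ℚ.∣ s n ∣) → Null s → Null u
null-dominated le null ε ε>0 with null ε ε>0
... | N , h = N , λ n p → ℚ.≤-<-trans (le n) (h n p)

null-cong : ∀ {s u} → (∀ n → s n ≡ u n) → Null s → Null u
null-cong eq = null-dominated λ n → ℚ.≤-reflexive (cong ℚ.∣_∣ (sym (eq n)))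

null-neg : ∀ {s} → Null s → Null (λ n → ℚ.- s n)
null-neg {s} = null-dominated λ n → ℚ.≤-reflexive (ℚ.∣-p∣≡∣p∣ (s n))

null-+ : ∀ {s u} → Null s → Null u → Null (λ n → s n ℚ.+ u n)
null-+ {s} {u} ns nu ε ε>0 with ns _ (half-pos ε>0) | nu _ (half-pos ε>0)
... | M , hM | N , hN = M ℕ.⊔ N , λ n p → begin-strict
    ℚ.∣ s n ℚ.+ u n ∣          ≤⟨ ℚ.∣p+q∣≤∣p∣+∣q∣ (s n) (u n) ⟩
    ℚ.∣ s n ∣ ℚ.+ ℚ.∣ u n ∣    <⟨ ℚ.+-mono-< (hM n (ℕ.m⊔n≤o⇒m≤o M N p)) (hN n (ℕ.m⊔n≤o⇒n≤o M N p)) ⟩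
    ε ℚ.* ½ ℚ.+ ε ℚ.* ½        ≡⟨ half+half ε ⟩
    ε                          ∎
  where open ℚ.≤-Reasoning

divide : ∀ B .{{_ : Positive B}} ε → 0ℚ ℚ.< ε → ∃ λ δ → 0ℚ ℚ.< δ × B ℚ.* δ ≡ ε
divide B ε ε>0 = 1/B ℚ.* ε ,
    ℚ.positive⁻¹ _ {{ℚ.pos*pos⇒pos 1/B {{ℚ.1/pos⇒pos B}} ε {{ℚ.positive ε>0}}}} ,
    trans (sym (ℚ.*-assoc B 1/B ε)) (trans (cong (ℚ._* ε) (ℚ.*-inverseʳ B)) (ℚ.*-identityˡ ε))
  where
  instance _ = ℚ.pos⇒nonZero B
  1/B = ℚ.1/ B

null-* : ∀ {s u} → Bounded s → Null u → Null (λ n → s n ℚ.* u n)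
null-* {s} {u} (B , B>0 , M , hM) nu ε ε>0 with divide B {{B>0}} ε ε>0
... | δ , δ>0 , eq with nu δ δ>0
...   | N , hN = M ℕ.⊔ N , λ n p → begin-strict
    ℚ.∣ s n ℚ.* u n ∣          ≡⟨ ℚ.∣p*q∣≡∣p∣*∣q∣ (s n) (u n) ⟩
    ℚ.∣ s n ∣ ℚ.* ℚ.∣ u n ∣    ≤⟨ ℚ.*-monoʳ-≤-nonNeg ℚ.∣ u n ∣ {{ℚ.∣-∣-nonNeg (u n)}}
                                   (hM n (ℕ.m⊔n≤o⇒m≤o M N p)) ⟩
    B ℚ.* ℚ.∣ u n ∣            <⟨ ℚ.*-monoʳ-<-pos B {{B>0}} (hN n (ℕ.m⊔n≤o⇒n≤o M N p)) ⟩
    B ℚ.* δ                    ≡⟨ eq ⟩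
    ε                          ∎
  where open ℚ.≤-Reasoning

∣p∣≤∣q∣+∣p-q∣ : ∀ p q → ℚ.∣ p ∣ ℚ.≤ ℚ.∣ q ∣ ℚ.+ ℚ.∣ p ℚ.- q ∣
∣p∣≤∣q∣+∣p-q∣ p q = subst (λ r → ℚ.∣ r ∣ ℚ.≤ ℚ.∣ q ∣ ℚ.+ ℚ.∣ p ℚ.- q ∣)
  (solve 2 (λ p q → q :+ (p :- q) := p) refl p q) (ℚ.∣p+q∣≤∣p∣+∣q∣ q (p ℚ.- q))
  where open +-*-Solver

cauchy⇒bounded : ∀ {s} → IsCauchy s → Bounded s
cauchy⇒bounded {s} cs with cs 1ℚ (ℚ.positive⁻¹ 1ℚ)
... | N , h = ℚ.∣ s N ∣ ℚ.+ 1ℚ , ℚ.nonNeg+pos⇒pos ℚ.∣ s N ∣ {{ℚ.∣-∣-nonNeg (s N)}} 1ℚ , N , λ n p →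
  ℚ.≤-trans (∣p∣≤∣q∣+∣p-q∣ (s n) (s N)) (ℚ.+-monoʳ-≤ ℚ.∣ s N ∣ (ℚ.<⇒≤ (h n N p ℕ.≤-refl)))

pointwise⇒≈ℝ : ∀ {x y} → (∀ n → seq x n ≡ seq y n) → x ≈ℝ y
pointwise⇒≈ℝ {x} {y} eq ε ε>0 = 0 , λ n _ → subst (ℚ._< ε)
  (sym (cong ℚ.∣_∣ (trans (cong (ℚ._- seq y n) (eq n)) (ℚ.+-inverseʳ (seq y n))))) ε>0

module _ where
  open +-*-Solver

  ≈ℝ-sym : ∀ {x y} → x ≈ℝ y → y ≈ℝ x
  ≈ℝ-sym {x} {y} p = null-cong
    (λ n → solve 2 (λ a b → :- (a :- b) := b :- a) refl (seq x n) (seq y n)) (null-neg p)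

  ≈ℝ-trans : ∀ {x y z} → x ≈ℝ y → y ≈ℝ z → x ≈ℝ z
  ≈ℝ-trans {x} {y} {z} p q = null-cong
    (λ n → solve 3 (λ a b c → (a :- b) :+ (b :- c) := a :- c) refl (seq x n) (seq y n) (seq z n))
    (null-+ p q)

  +ℝ-cong : ∀ {x x′ y y′} → x ≈ℝ x′ → y ≈ℝ y′ → x +ℝ y ≈ℝ x′ +ℝ y′
  +ℝ-cong {x} {x′} {y} {y′} p q = null-cong
    (λ n → solve 4 (λ a b c d → (a :- b) :+ (c :- d) := (a :+ c) :- (b :+ d)) refl
      (seq x n) (seq x′ n) (seq y n) (seq y′ n))
    (null-+ p q)

  -ℝ-cong : ∀ {x y} → x ≈ℝ y → -ℝ x ≈ℝ -ℝ y
  -ℝ-cong {x} {y} p = null-cong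
    (λ n → solve 2 (λ a b → :- (a :- b) := (:- a) :- (:- b)) refl (seq x n) (seq y n)) (null-neg p)

  *ℝ-cong : ∀ {x x′ y y′} → x ≈ℝ x′ → y ≈ℝ y′ → x *ℝ y ≈ℝ x′ *ℝ y′
  *ℝ-cong {x} {x′} {y} {y′} p q = null-cong
    (λ n → solve 4 (λ a b c d → a :* (c :- d) :+ d :* (a :- b) := a :* c :- b :* d) refl
      (seq x n) (seq x′ n) (seq y n) (seq y′ n))
    (null-+ {λ n → seq x n ℚ.* (seq y n ℚ.- seq y′ n)} (null-* {seq x} (cauchy⇒bounded (cauchy x)) q)
            (null-* {seq y′} (cauchy⇒bounded (cauchy y′)) p))

  ≈ℝ0⇒null : ∀ {x} → x ≈ℝ 0ℝ → Null (seq x)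
  ≈ℝ0⇒null {x} = null-cong (λ n → solve 1 (λ a → a :- con 0ℚ := a) refl (seq x n))

  null⇒≈ℝ0 : ∀ {x} → Null (seq x) → x ≈ℝ 0ℝ
  null⇒≈ℝ0 {x} = null-cong (λ n → solve 1 (λ a → a := a :- con 0ℚ) refl (seq x n))

-- Either the tail of y is within ε, which settles y ≈ 0 at this precision, or y stays
-- away from zero by ε/4, and then x y ≈ 0 would force x ≈ 0.
*ℝ-cancelˡ-0 : ∀ {x y} → ¬ (x ≈ℝ 0ℝ) → x *ℝ y ≈ℝ 0ℝ → y ≈ℝ 0ℝ
*ℝ-cancelˡ-0 {x} {y} x≉0 xy≈0 = null⇒≈ℝ0 {y} null-y
  where
  open ℚ.≤-Reasoning
  null-y : Null (seq y)
  null-y ε ε>0 with cauchy y _ (half-pos (half-pos ε>0))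
  ... | N , h with ℚ.∣ seq y N ∣ ℚ.<? ε ℚ.* ½
  ...   | yes small = N , λ n p → begin-strict
      ℚ.∣ seq y n ∣                                  ≤⟨ ∣p∣≤∣q∣+∣p-q∣ (seq y n) (seq y N) ⟩
      ℚ.∣ seq y N ∣ ℚ.+ ℚ.∣ seq y n ℚ.- seq y N ∣    <⟨ ℚ.+-mono-< small (h n N p ℕ.≤-refl) ⟩
      δ ℚ.+ η                                        ≤⟨ ℚ.+-monoʳ-≤ δ η≤δ ⟩
      δ ℚ.+ δ                                        ≡⟨ half+half ε ⟩
      ε                                              ∎
    where
    δ = ε ℚ.* ½
    η = δ ℚ.* ½
    η≤δ : η ℚ.≤ δ
    η≤δ = begin
      η           ≡⟨ ℚ.+-identityˡ η ⟨
      0ℚ ℚ.+ η    ≤⟨ ℚ.+-monoˡ-≤ η (ℚ.<⇒≤ (half-pos (half-pos ε>0))) ⟩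
      η ℚ.+ η     ≡⟨ half+half δ ⟩
      δ           ∎
  ...   | no large = contradiction (null⇒≈ℝ0 {x} null-x) x≉0
    where
    δ = ε ℚ.* ½
    η = δ ℚ.* ½
    instance
      η-pos : Positive η
      η-pos = ℚ.positive (half-pos (half-pos ε>0))

    away : ∀ n → N ℕ.≤ n → η ℚ.≤ ℚ.∣ seq y n ∣
    away n p = ℚ.≮⇒≥ λ near → large (begin-strict
      ℚ.∣ seq y N ∣                                   ≤⟨ ∣p∣≤∣q∣+∣p-q∣ (seq y N) (seq y n) ⟩
      ℚ.∣ seq y n ∣ ℚ.+ ℚ.∣ seq y N ℚ.- seq y n ∣     <⟨ ℚ.+-mono-< near (h N n ℕ.≤-refl p) ⟩
      η ℚ.+ η                                         ≡⟨ half+half δ ⟩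
      δ                                               ∎)

    null-x : Null (seq x)
    null-x ξ ξ>0 with ≈ℝ0⇒null {x *ℝ y} xy≈0 (ξ ℚ.* η)
                        (ℚ.positive⁻¹ _ {{ℚ.pos*pos⇒pos ξ {{ℚ.positive ξ>0}} η}})
    ... | M , hM = M ℕ.⊔ N , λ n p → ℚ.*-cancelʳ-<-nonNeg η {{ℚ.pos⇒nonNeg η}} (begin-strict
      ℚ.∣ seq x n ∣ ℚ.* η                ≤⟨ ℚ.*-monoˡ-≤-nonNeg ℚ.∣ seq x n ∣ {{ℚ.∣-∣-nonNeg (seq x n)}}
                                              (away n (ℕ.m⊔n≤o⇒n≤o M N p)) ⟩
      ℚ.∣ seq x n ∣ ℚ.* ℚ.∣ seq y n ∣    ≡⟨ ℚ.∣p*q∣≡∣p∣*∣q∣ (seq x n) (seq y n) ⟨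
      ℚ.∣ seq x n ℚ.* seq y n ∣          <⟨ hM n (ℕ.m⊔n≤o⇒m≤o M N p) ⟩
      ξ ℚ.* η                            ∎)

p²≡∣p∣² : ∀ p → p ℚ.* p ≡ ℚ.∣ p ∣ ℚ.* ℚ.∣ p ∣
p²≡∣p∣² p with ℚ.∣ p ∣ | ℚ.∣p∣≡p∨∣p∣≡-p p
... | _ | inj₁ refl = refl
... | _ | inj₂ refl = solve 1 (λ p → p :* p := (:- p) :* (:- p)) refl p
  where open +-*-Solver

0≤* : ∀ {p q} → 0ℚ ℚ.≤ p → 0ℚ ℚ.≤ q → 0ℚ ℚ.≤ p ℚ.* q
0≤* {p} {q} hp hq = ℚ.nonNegative⁻¹ _
  {{ℚ.nonNeg*nonNeg⇒nonNeg p {{ℚ.nonNegative hp}} q {{ℚ.nonNegative hq}}}}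

0≤p² : ∀ p → 0ℚ ℚ.≤ p ℚ.* p
0≤p² p = subst (0ℚ ℚ.≤_) (sym (p²≡∣p∣² p)) (0≤* (ℚ.0≤∣p∣ p) (ℚ.0≤∣p∣ p))

-- If a term of x had absolute value at least ε, the sum of squares would be at least ε² there; so
-- precision ε² for the sum gives precision ε for x.
sumOfSquares-0 : ∀ {x y} → x *ℝ x +ℝ y *ℝ y ≈ℝ 0ℝ → x ≈ℝ 0ℝ
sumOfSquares-0 {x} {y} eq = null⇒≈ℝ0 {x} null-x
  where
  open ℚ.≤-Reasoning
  null-x : Null (seq x)
  null-x ε ε>0 with ≈ℝ0⇒null {x *ℝ x +ℝ y *ℝ y} eq (ε ℚ.* ε)
                      (ℚ.positive⁻¹ _ {{ℚ.pos*pos⇒pos ε {{ℚ.positive ε>0}} ε {{ℚ.positive ε>0}}}})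
  ... | N , h = N , λ n p → ℚ.≰⇒> λ ε≤ → ℚ.<⇒≢ (ℚ.<-≤-trans (h n p) (begin
      ε ℚ.* ε                                              ≤⟨ ℚ.*-monoˡ-≤-nonNeg ε {{ℚ.nonNegative (ℚ.<⇒≤ ε>0)}} ε≤ ⟩
      ε ℚ.* ℚ.∣ seq x n ∣                                  ≤⟨ ℚ.*-monoʳ-≤-nonNeg ℚ.∣ seq x n ∣
                                                                {{ℚ.∣-∣-nonNeg (seq x n)}} ε≤ ⟩
      ℚ.∣ seq x n ∣ ℚ.* ℚ.∣ seq x n ∣                      ≡⟨ p²≡∣p∣² (seq x n) ⟨
      seq x n ℚ.* seq x n                                  ≡⟨ ℚ.+-identityʳ _ ⟨
      seq x n ℚ.* seq x n ℚ.+ 0ℚ                           ≤⟨ ℚ.+-monoʳ-≤ (seq x n ℚ.* seq x n) (0≤p² (seq y n)) ⟩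
      seq x n ℚ.* seq x n ℚ.+ seq y n ℚ.* seq y n          ≡⟨ ℚ.0≤p⇒∣p∣≡p (ℚ.+-mono-≤ (0≤p² (seq x n))
                                                                               (0≤p² (seq y n))) ⟨
      ℚ.∣ seq x n ℚ.* seq x n ℚ.+ seq y n ℚ.* seq y n ∣    ∎)) refl

-- The operations act termwise, so ring identities in ℂ follow from identities in ℚ at each index,
-- without comparing Cauchy proofs.
pointwise⇒≈ : ∀ z w →
  (∀ n → seq (re z) n ≡ seq (re w) n) → (∀ n → seq (im z) n ≡ seq (im w) n) → z ≈ w
pointwise⇒≈ z w p q = pointwise⇒≈ℝ {re z} {re w} p , pointwise⇒≈ℝ {im z} {im w} q

≈-isEquivalence : IsEquivalence _≈_
≈-isEquivalence = record
  { refl  = λ {z} → pointwise⇒≈ z z (λ _ → refl) (λ _ → refl)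
  ; sym   = λ {z} {w} (p , q) → ≈ℝ-sym {re z} {re w} p , ≈ℝ-sym {im z} {im w} q
  ; trans = λ {z} {w} {u} (p , q) (p′ , q′) →
      ≈ℝ-trans {re z} {re w} {re u} p p′ , ≈ℝ-trans {im z} {im w} {im u} q q′
  }

ℂ-setoid : Setoid 0ℓ 0ℓ
ℂ-setoid = record { isEquivalence = ≈-isEquivalence }

module _ where
  open +-*-Solver
  open import Algebra.Consequences.Setoid ℂ-setoid

  +-cong : Congruent₂ _≈_ _+_
  +-cong {z} {z′} {w} {w′} (p , q) (p′ , q′) =
    +ℝ-cong {re z} {re z′} {re w} {re w′} p p′ , +ℝ-cong {im z} {im z′} {im w} {im w′} q q′

  *-cong : Congruent₂ _≈_ _*_
  *-cong {z} {z′} {w} {w′} (p , q) (p′ , q′) =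
    +ℝ-cong {re z *ℝ re w} {re z′ *ℝ re w′} { -ℝ (im z *ℝ im w)} { -ℝ (im z′ *ℝ im w′)}
      (*ℝ-cong {re z} {re z′} {re w} {re w′} p p′)
      (-ℝ-cong {im z *ℝ im w} {im z′ *ℝ im w′} (*ℝ-cong {im z} {im z′} {im w} {im w′} q q′)) ,
    +ℝ-cong {re z *ℝ im w} {re z′ *ℝ im w′} {im z *ℝ re w} {im z′ *ℝ re w′}
      (*ℝ-cong {re z} {re z′} {im w} {im w′} p q′)
      (*ℝ-cong {im z} {im z′} {re w} {re w′} q p′)

  +-comm : Commutative _≈_ _+_
  +-comm z w = pointwise⇒≈ (z + w) (w + z)
    (λ n → ℚ.+-comm (seq (re z) n) (seq (re w) n)) (λ n → ℚ.+-comm (seq (im z) n) (seq (im w) n))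

  *-comm : Commutative _≈_ _*_
  *-comm z w = pointwise⇒≈ (z * w) (w * z)
    (λ n → solve 4 (λ a b c d → a :* c :+ :- (b :* d) := c :* a :+ :- (d :* b)) refl
      (seq (re z) n) (seq (im z) n) (seq (re w) n) (seq (im w) n))
    (λ n → solve 4 (λ a b c d → a :* d :+ b :* c := c :* b :+ d :* a) refl
      (seq (re z) n) (seq (im z) n) (seq (re w) n) (seq (im w) n))

  *-assoc : Associative _≈_ _*_
  *-assoc z w u = pointwise⇒≈ ((z * w) * u) (z * (w * u))
    (λ n → solve 6 (λ a b c d e f →
        (a :* c :+ :- (b :* d)) :* e :+ :- ((a :* d :+ b :* c) :* f) :=
        a :* (c :* e :+ :- (d :* f)) :+ :- (b :* (c :* f :+ d :* e))) refl
      (seq (re z) n) (seq (im z) n) (seq (re w) n) (seq (im w) n) (seq (re u) n) (seq (im u) n))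
    (λ n → solve 6 (λ a b c d e f →
        (a :* c :+ :- (b :* d)) :* f :+ (a :* d :+ b :* c) :* e :=
        a :* (c :* f :+ d :* e) :+ b :* (c :* e :+ :- (d :* f))) refl
      (seq (re z) n) (seq (im z) n) (seq (re w) n) (seq (im w) n) (seq (re u) n) (seq (im u) n))

  *-identityˡ : LeftIdentity _≈_ 1ℂ _*_
  *-identityˡ z = pointwise⇒≈ (1ℂ * z) z
    (λ n → solve 2 (λ a b → con 1ℚ :* a :+ :- (con 0ℚ :* b) := a) refl (seq (re z) n) (seq (im z) n))
    (λ n → solve 2 (λ a b → con 1ℚ :* b :+ con 0ℚ :* a := b) refl (seq (re z) n) (seq (im z) n))

  *-distribˡ-+ : _DistributesOverˡ_ _≈_ _*_ _+_
  *-distribˡ-+ z w u = pointwise⇒≈ (z * (w + u)) (z * w + z * u)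
    (λ n → solve 6 (λ a b c d e f →
        a :* (c :+ e) :+ :- (b :* (d :+ f)) :=
        (a :* c :+ :- (b :* d)) :+ (a :* e :+ :- (b :* f))) refl
      (seq (re z) n) (seq (im z) n) (seq (re w) n) (seq (im w) n) (seq (re u) n) (seq (im u) n))
    (λ n → solve 6 (λ a b c d e f →
        a :* (d :+ f) :+ b :* (c :+ e) := (a :* d :+ b :* c) :+ (a :* f :+ b :* e)) refl
      (seq (re z) n) (seq (im z) n) (seq (re w) n) (seq (im w) n) (seq (re u) n) (seq (im u) n))

  ℂ-isCommutativeRing : IsCommutativeRing _≈_ _+_ _*_ -_ 0ℂ 1ℂ
  ℂ-isCommutativeRing = record
    { isRing = record
      { +-isAbelianGroup = record
        { isGroup = record
          { isMonoid = record
            { isSemigroup = record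
              { isMagma = record
                { isEquivalence = ≈-isEquivalence
                ; ∙-cong = λ {z} {z′} {w} {w′} → +-cong {z} {z′} {w} {w′}
                }
              ; assoc = λ z w u → pointwise⇒≈ ((z + w) + u) (z + (w + u))
                  (λ n → ℚ.+-assoc (seq (re z) n) (seq (re w) n) (seq (re u) n))
                  (λ n → ℚ.+-assoc (seq (im z) n) (seq (im w) n) (seq (im u) n))
              }
            ; identity = comm∧idˡ⇒id {_∙_ = _+_} +-comm {0ℂ} λ z → pointwise⇒≈ (0ℂ + z) z
                (λ n → ℚ.+-identityˡ (seq (re z) n)) (λ n → ℚ.+-identityˡ (seq (im z) n))
            }
          ; inverse = comm∧invˡ⇒inv {_∙_ = _+_} { -_} {0ℂ} +-comm λ z → pointwise⇒≈ (- z + z) 0ℂ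
              (λ n → ℚ.+-inverseˡ (seq (re z) n)) (λ n → ℚ.+-inverseˡ (seq (im z) n))
          ; ⁻¹-cong = λ {z} {w} (p , q) → -ℝ-cong {re z} {re w} p , -ℝ-cong {im z} {im w} q
          }
        ; comm = +-comm
        }
      ; *-cong = λ {z} {z′} {w} {w′} → *-cong {z} {z′} {w} {w′}
      ; *-assoc = *-assoc
      ; *-identity = comm∧idˡ⇒id {_∙_ = _*_} *-comm {1ℂ} *-identityˡ
      ; distrib = comm∧distrˡ⇒distr {_∙_ = _*_} {_+_}
          (λ {z} {z′} {w} {w′} → +-cong {z} {z′} {w} {w′}) *-comm *-distribˡ-+
      }
    ; *-comm = *-comm
    }

ℂ-commutativeRing : CommutativeRing 0ℓ 0ℓ
ℂ-commutativeRing = record { isCommutativeRing = ℂ-isCommutativeRing }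

open Elimination ℂ-commutativeRing
  using (NoZeroDivisors; HasLength≤; geometricSum; 1^k≈1; rootOfUnity≈1; module Conjugation; module Sylvester)
  renaming (eval to evalʳ; coeff to coeffʳ)
module C = CommutativeRing ℂ-commutativeRing

-- Complex conjugation and cancellation in ℂ

conj : ℂ → ℂ
conj z = re z +i (-ℝ im z)

module _ where
  open +-*-Solver

  conj-cong : ∀ z w → z ≈ w → conj z ≈ conj w
  conj-cong z w (p , q) = p , -ℝ-cong {im z} {im w} q

  conj-isRingHomomorphism : IsRingHomomorphism C.rawRing C.rawRing conj
  conj-isRingHomomorphism = record
    { isSemiringHomomorphism = record
      { isNearSemiringHomomorphism = record
        { +-isMonoidHomomorphism = record
          { isMagmaHomomorphism = record
            { isRelHomomorphism = record { cong = λ {z} {w} → conj-cong z w }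
            ; homo = λ z w → pointwise⇒≈ (conj (z + w)) (conj z + conj w) (λ n → refl)
                (λ n → ℚ.neg-distrib-+ (seq (im z) n) (seq (im w) n))
            }
          ; ε-homo = pointwise⇒≈ (conj 0ℂ) 0ℂ (λ n → refl) (λ n → refl)
          }
        ; *-homo = λ z w → pointwise⇒≈ (conj (z * w)) (conj z * conj w)
            (λ n → solve 4 (λ a b c d → a :* c :+ :- (b :* d) := a :* c :+ :- ((:- b) :* (:- d))) refl
              (seq (re z) n) (seq (im z) n) (seq (re w) n) (seq (im w) n))
            (λ n → solve 4 (λ a b c d → :- (a :* d :+ b :* c) := a :* (:- d) :+ (:- b) :* c) refl
              (seq (re z) n) (seq (im z) n) (seq (re w) n) (seq (im w) n))
        }
      ; 1#-homo = pointwise⇒≈ (conj 1ℂ) 1ℂ (λ n → refl) (λ n → refl)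
      }
    ; -‿homo = λ z → pointwise⇒≈ (conj (- z)) (- (conj z)) (λ n → refl) (λ n → refl)
    }

  conj-≉0 : ∀ z → z ≉ 0ℂ → conj z ≉ 0ℂ
  conj-≉0 z z≉0 (p , q) = z≉0 (p , null-cong
    (λ n → solve 1 (λ a → :- ((:- a) :- con 0ℚ) := a :- con 0ℚ) refl (seq (im z) n)) (null-neg q))

  normSq : ℂ → ℝ
  normSq z = re z *ℝ re z +ℝ im z *ℝ im z

  normSq≈0 : ∀ z → normSq z ≈ℝ 0ℝ → z ≈ 0ℂ
  normSq≈0 z eq = sumOfSquares-0 {re z} {im z} eq , sumOfSquares-0 {im z} {re z}
    (null-cong (λ n → cong (ℚ._- 0ℚ)
      (ℚ.+-comm (seq (re z) n ℚ.* seq (re z) n) (seq (im z) n ℚ.* seq (im z) n))) eq)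

  -- Multiplying zw = 0 by the conjugate of z gives |z|² w = 0. The real number |z|² is nonzero and
  -- is cancelled in each coordinate of w.
  ℂ-noZeroDivisors : NoZeroDivisors
  ℂ-noZeroDivisors {z} {w} z≉0 zw≈0 =
    cancel (re w) (null-cong reEq (proj₁ z̄zw≈0)) , cancel (im w) (null-cong imEq (proj₂ z̄zw≈0))
    where
    z̄zw≈0 : conj z * (z * w) ≈ 0ℂ
    z̄zw≈0 = C.trans {conj z * (z * w)} {conj z * 0ℂ} {0ℂ}
      (C.*-congˡ {conj z} {z * w} {0ℂ} zw≈0) (C.zeroʳ (conj z))
    cancel : ∀ y → normSq z *ℝ y ≈ℝ 0ℝ → y ≈ℝ 0ℝ
    cancel y = *ℝ-cancelˡ-0 {normSq z} {y} λ eq → z≉0 (normSq≈0 z eq)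
    reEq : ∀ n → seq (re (conj z * (z * w))) n ℚ.- 0ℚ ≡ seq (normSq z *ℝ re w) n ℚ.- 0ℚ
    reEq n = cong (ℚ._- 0ℚ) (solve 4 (λ a b c d →
        a :* (a :* c :+ :- (b :* d)) :+ :- ((:- b) :* (a :* d :+ b :* c)) := (a :* a :+ b :* b) :* c) refl
      (seq (re z) n) (seq (im z) n) (seq (re w) n) (seq (im w) n))
    imEq : ∀ n → seq (im (conj z * (z * w))) n ℚ.- 0ℚ ≡ seq (normSq z *ℝ im w) n ℚ.- 0ℚ
    imEq n = cong (ℚ._- 0ℚ) (solve 4 (λ a b c d →
        a :* (a :* d :+ b :* c) :+ (:- b) :* (a :* c :+ :- (b :* d)) := (a :* a :+ b :* b) :* d) refl
      (seq (re z) n) (seq (im z) n) (seq (re w) n) (seq (im w) n))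

-- Roots of unity have modulus 1

-- A condition on the representing sequences, not invariant under `≈`. It can be checked term by
-- term, and `z * conj z` satisfies it exactly.
NonNegReal : ℂ → Set
NonNegReal z = ∀ n → 0ℚ ℚ.≤ seq (re z) n × seq (im z) n ≡ 0ℚ

nonNegReal-1 : NonNegReal 1ℂ
nonNegReal-1 n = ℚ.<⇒≤ (ℚ.positive⁻¹ 1ℚ) , refl

nonNegReal-+ : ∀ z w → NonNegReal z → NonNegReal w → NonNegReal (z + w)
nonNegReal-+ z w hz hw n =
  ℚ.+-mono-≤ (proj₁ (hz n)) (proj₁ (hw n)) , cong₂ ℚ._+_ (proj₂ (hz n)) (proj₂ (hw n))

nonNegReal-* : ∀ z w → NonNegReal z → NonNegReal w → NonNegReal (z * w)
nonNegReal-* z w hz hw n with hz n | hw n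
... | a≥0 , b≡0 | c≥0 , d≡0 =
    subst (0ℚ ℚ.≤_) (sym (trans (cong₂ (λ b d → seq (re z) n ℚ.* seq (re w) n ℚ.- b ℚ.* d) b≡0 d≡0)
      (ℚ.+-identityʳ _))) (0≤* a≥0 c≥0) ,
    trans (cong₂ (λ b d → seq (re z) n ℚ.* d ℚ.+ b ℚ.* seq (re w) n) b≡0 d≡0)
      (trans (cong₂ ℚ._+_ (ℚ.*-zeroʳ (seq (re z) n)) (ℚ.*-zeroˡ (seq (re w) n))) refl)

nonNegReal-geometricSum : ∀ z k → NonNegReal z → NonNegReal (geometricSum z k)
nonNegReal-geometricSum z zero    h n = ℚ.≤-refl , refl
nonNegReal-geometricSum z (suc k) h = nonNegReal-+ 1ℂ (z * geometricSum z k) nonNegReal-1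
  (nonNegReal-* z (geometricSum z k) h (nonNegReal-geometricSum z k h))

1+nonNegReal≉0 : ∀ z → NonNegReal z → 1ℂ + z ≉ 0ℂ
1+nonNegReal≉0 z h (eq , _) with eq 1ℚ (ℚ.positive⁻¹ 1ℚ)
... | N , small = ℚ.<⇒≢ (ℚ.<-≤-trans (small N ℕ.≤-refl) (begin
    1ℚ                                     ≤⟨ ℚ.+-monoʳ-≤ 1ℚ (proj₁ (h N)) ⟩
    1ℚ ℚ.+ seq (re z) N                    ≡⟨ ℚ.0≤p⇒∣p∣≡p (ℚ.+-mono-≤ (proj₁ (nonNegReal-1 N)) (proj₁ (h N))) ⟨
    ℚ.∣ 1ℚ ℚ.+ seq (re z) N ∣              ≡⟨ cong ℚ.∣_∣ (ℚ.+-identityʳ _) ⟨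
    ℚ.∣ 1ℚ ℚ.+ seq (re z) N ℚ.- 0ℚ ∣       ∎)) refl
  where
  open ℚ.≤-Reasoning

nonNegReal-norm : ∀ z → NonNegReal (z * conj z)
nonNegReal-norm z n =
  subst (0ℚ ℚ.≤_)
    (solve 2 (λ a b → a :* a :+ b :* b := a :* a :+ :- (b :* (:- b))) refl (seq (re z) n) (seq (im z) n))
    (ℚ.+-mono-≤ (0≤p² (seq (re z) n)) (0≤p² (seq (im z) n))) ,
  solve 2 (λ a b → a :* (:- b) :+ b :* a := con 0ℚ) refl (seq (re z) n) (seq (im z) n)
  where open +-*-Solver

open Conjugation conj conj-isRingHomomorphism

-- The geometric sum of a nonnegative real has all terms at least 1, so it is nonzero and can be
-- cancelled from z ^ (k + 1) - 1. The exponent must be positive, since z ^ 0 is 1 for every z.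
nonNegReal-root≈1 : ∀ k z → NonNegReal z → z ^ suc k ≈ 1ℂ → z ≈ 1ℂ
nonNegReal-root≈1 k z h = rootOfUnity≈1 (λ {z} {w} → ℂ-noZeroDivisors {z} {w}) (suc k) {z}
  (1+nonNegReal≉0 (z * geometricSum z k)
    (nonNegReal-* z (geometricSum z k) h (nonNegReal-geometricSum z k h)))

μ-norm : ∀ {t} → t > 0 → ∀ h → μ t h → h * conj h ≈ 1ℂ
μ-norm {suc k} _ h h^t≈1 =
  nonNegReal-root≈1 k (h * conj h) (nonNegReal-norm h) (norm-^ h (suc k) h^t≈1)

evalʳ≈eval : ∀ f x → evalʳ f x ≈ eval f x
evalʳ≈eval []      x = C.refl {0ℂ}
evalʳ≈eval (a ∷ f) x = C.trans {evalʳ (a ∷ f) x} {a C.+ (x C.* eval f x)} {eval (a ∷ f) x}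
  (C.+-congˡ {a} {x C.* evalʳ f x} {x C.* eval f x}
    (C.*-congˡ {x} {evalʳ f x} {eval f x} (evalʳ≈eval f x)))
  -- By sequences, because refl would have to compare the proofs of the Cauchy property.
  (pointwise⇒≈ (a C.+ (x C.* eval f x)) (a + x * eval f x) (λ n → refl) (λ n → refl))

evalʳ-resp : ∀ f x z → eval f x ≈ z → evalʳ f x ≈ z
evalʳ-resp f x z = C.trans {evalʳ f x} {eval f x} {z} (evalʳ≈eval f x)

eval-resp : ∀ f x z → evalʳ f x ≈ z → eval f x ≈ z
eval-resp f x z = C.trans {eval f x} {evalʳ f x} {z} (C.sym {evalʳ f x} {eval f x} (evalʳ≈eval f x))

coeffʳ≡coeff : ∀ f k → coeffʳ f k ≡ coeff f k
coeffʳ≡coeff []      k       = refl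
coeffʳ≡coeff (a ∷ f) zero    = refl
coeffʳ≡coeff (a ∷ f) (suc k) = coeffʳ≡coeff f k

nonZero-* : ∀ {z w} → z ≉ 0ℂ → w ≉ 0ℂ → z * w ≉ 0ℂ
nonZero-* {z} {w} z≉0 w≉0 zw≈0 = w≉0 (ℂ-noZeroDivisors {z} {w} z≉0 zw≈0)

-- Points of M

InCosets : (t : ℕ) (g₁ g₂ : ℂ) (f₁ f₂ : ℂ[x]) → ℂ → Set
InCosets t g₁ g₂ f₁ f₂ x = coset g₁ (μ t) (eval f₁ x) × coset g₂ (μ t) (eval f₂ x)

-- The case of `fewCommonZeros` in which e₁, e₂ are the conjugate polynomials, w is the conjugate of
-- z, and rᵢ = |gᵢ|². Here r₁ is nonzero because g₁ is, and e₂ has nonzero leading coefficient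
-- because f₂ has exact degree.
fewInCosets : ∀ m₁ m₂ {t} → t > 0 → ∀ g₁ g₂ f₁ f₂ → g₁ ≉ 0ℂ →
  HasDegree f₁ (suc m₁) → HasDegree f₂ (suc m₂) →
  ∀ x → eval f₁ x ≈ 0ℂ → eval f₂ x ≉ 0ℂ →
  ∀ xs → AllPairs _≉_ xs → All (InCosets t g₁ g₂ f₁ f₂) xs →
  length xs ℕ.< 2 ℕ.^ (m₁ +ₙ suc m₂) *ₙ suc (suc m₁ +ₙ suc m₂)
fewInCosets m₁ m₂ {t} t>0 g₁ g₂ f₁ f₂ g₁≉0 (_ , tail₁) (lc₂ , tail₂) x f₁x≈0 f₂x≉0 xs distinct inCosets =
  S.fewCommonZeros (λ {z} {w} → ℂ-noZeroDivisors {z} {w}) {x}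
    (evalʳ-resp f₁ x 0ℂ f₁x≈0)
    (λ eq → f₂x≉0 (eval-resp f₂ x 0ℂ eq))
    (nonZero-* {g₁} {conj g₁} g₁≉0 (conj-≉0 g₁ g₁≉0))
    (λ eq → conj-≉0 (coeff f₂ (suc m₂)) lc₂ (C.trans
      {conj (coeff f₂ (suc m₂))} {coeffʳ (map conj f₂) (suc m₂)} {0ℂ}
      (C.sym {coeffʳ (map conj f₂) (suc m₂)} {conj (coeff f₂ (suc m₂))}
        (subst (λ c → coeffʳ (map conj f₂) (suc m₂) ≈ conj c) (coeffʳ≡coeff f₂ (suc m₂))
          (coeff-conj f₂ (suc m₂)))) eq))
    xs distinct
    (All.map (λ {z} ((h₁ , μ₁ , eq₁) , (h₂ , μ₂ , eq₂)) → conj z ,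
      onCircle f₁ g₁ h₁ z μ₁ eq₁ , onCircle f₂ g₂ h₂ z μ₂ eq₂) inCosets)
  where
  shortʳ : ∀ d f → (∀ k → d ℕ.< k → coeff f k ≈ 0ℂ) → HasLength≤ (suc d) f
  shortʳ d f tail k d<k = subst (_≈ 0ℂ) (sym (coeffʳ≡coeff f k)) (tail k d<k)
  onCircle : ∀ f g h z → μ t h → eval f z ≈ g * h →
    evalʳ f z * evalʳ (map conj f) (conj z) ≈ g * conj g
  onCircle f g h z h∈μ eq = norm-eval f {z} {g} {h}
    (evalʳ-resp f z (g * h) eq) (μ-norm t>0 h h∈μ)
  module S = Sylvester m₁ m₂ f₁ f₂ (map conj f₁) (map conj f₂) (g₁ * conj g₁) (g₂ * conj g₂)
    (shortʳ (suc m₁) f₁ tail₁) (shortʳ (suc m₂) f₂ tail₂)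
    (conj-length (suc (suc m₁)) f₁ (shortʳ (suc m₁) f₁ tail₁))
    (conj-length (suc (suc m₂)) f₂ (shortʳ (suc m₂) f₂ tail₂))

-- Comparing a constant with the power of the group order

≤-rootBelow : ∀ k a {b} c → b ℕ.≤ c → b ℕ.^ k ℕ.≤ a → b ℕ.≤ rootBelow k a c
≤-rootBelow k a zero    z≤n _ = z≤n
≤-rootBelow k a {b} (suc c) b≤c b^k≤a with suc c ℕ.^ k ℕ.≤? a
... | yes _ = b≤c
... | no c^k≰a with ℕ.m≤n⇒m<n∨m≡n b≤c
...   | inj₁ (s≤s b≤c′) = ≤-rootBelow k a c b≤c′ b^k≤a
...   | inj₂ refl       = contradiction b^k≤a c^k≰a

/-mono-≤ : ∀ a b c d → a ℕ.* suc d ℕ.≤ c ℕ.* suc b → (+ a ℚ./ suc b) ℚ.≤ (+ c ℚ./ suc d)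
/-mono-≤ a b c d h = ℚ.toℚᵘ-cancel-≤
  (ℚᵘ.≤-respʳ-≃ (ℚᵘ.≃-sym (ℚ.toℚᵘ-fromℚᵘ (ℚᵘ.mkℚᵘ (+ c) d)))
    (ℚᵘ.≤-respˡ-≃ (ℚᵘ.≃-sym (ℚ.toℚᵘ-fromℚᵘ (ℚᵘ.mkℚᵘ (+ a) b)))
      (ℚᵘ.*≤* (subst₂ ℤ._≤_ (ℤ.pos-* a (suc d)) (ℤ.pos-* c (suc b)) (ℤ.+≤+ h)))))

-- From a ≥ 1 follows (j + 1) ^ k ≤ a (j + 1) ^ k, so the integer root is at least j + 1. The bound
-- holds for every approximation, not only in the limit.
1≤rootSeq : ∀ k .{{_ : NonZero k}} a .{{_ : NonZero a}} j → 1ℚ ℚ.≤ rootSeq k a j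
1≤rootSeq k a j = /-mono-≤ 1 0 (⌊root⌋ k b) j (begin
    1 ℕ.* suc j               ≡⟨ ℕ.*-identityˡ (suc j) ⟩
    suc j                     ≤⟨ ≤-rootBelow k b b (ℕ.≤-trans base≤power below) below ⟩
    ⌊root⌋ k b                ≡⟨ ℕ.*-identityʳ _ ⟨
    ⌊root⌋ k b ℕ.* 1          ∎)
  where
  open ℕ.≤-Reasoning
  b = a ℕ.* suc j ℕ.^ k
  base≤power : suc j ℕ.≤ suc j ℕ.^ k
  base≤power = ℕ.≤-trans (ℕ.≤-reflexive (sym (ℕ.*-identityʳ (suc j))))
    (ℕ.^-monoʳ-≤ (suc j) (ℕ.>-nonZero⁻¹ k))
  below : suc j ℕ.^ k ℕ.≤ b
  below = ℕ.m≤n*m (suc j ℕ.^ k) a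

fromℕ≤scaledRoot : ∀ {l c} → l ℕ.≤ c → ∀ k .{{_ : NonZero k}} a .{{_ : NonZero a}} →
  fromℕ l ≤ℝ fromℕ c *ℝ root k a
fromℕ≤scaledRoot {l} {c} l≤c k a ε ε>0 = 0 , λ j _ → begin
    + l ℚ./ 1                                        ≤⟨ /-mono-≤ l 0 c 0 (ℕ.*-monoˡ-≤ 1 l≤c) ⟩
    + c ℚ./ 1                                        ≡⟨ ℚ.*-identityʳ _ ⟨
    + c ℚ./ 1 ℚ.* 1ℚ                                 ≤⟨ ℚ.*-monoˡ-≤-nonNeg (+ c ℚ./ 1) {{ℚ.normalize-nonNeg c 1}}
                                                          (1≤rootSeq k a j) ⟩
    + c ℚ./ 1 ℚ.* rootSeq k a j                      ≡⟨ ℚ.+-identityʳ _ ⟨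
    + c ℚ./ 1 ℚ.* rootSeq k a j ℚ.+ 0ℚ               ≤⟨ ℚ.+-monoʳ-≤ (+ c ℚ./ 1 ℚ.* rootSeq k a j) (ℚ.<⇒≤ ε>0) ⟩
    + c ℚ./ 1 ℚ.* rootSeq k a j ℚ.+ ε                ∎
  where open ℚ.≤-Reasoning

0<fromℕ : ∀ n .{{_ : NonZero n}} → 0ℝ <ℝ fromℕ n
0<fromℕ (suc n) = 1ℚ , ℚ.positive⁻¹ 1ℚ , 0 , λ _ _ → /-mono-≤ 1 0 (suc n) 0 (s≤s z≤n)

-- The group contains 1, so its order is positive, as `1≤rootSeq` requires of the radicand.
μ-nonEmpty : ∀ t {k} → HasCardinality (μ t) k → NonZero k
μ-nonEmpty t (xs , refl , _ , _ , all) = nonEmpty xs (all 1ℂ (1^k≈1 t))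
  where
  nonEmpty : ∀ xs → Any (1ℂ ≈_) xs → NonZero (length xs)
  nonEmpty (_ ∷ _) _ = _

theorem3 : ∀ (n : ℕ) (n≥2 : n ≥ 2) (m : Vector ℕ n) → (∀ i → m i > 0) →
    ∃ λ (C₁ : ℝ) → ∃ λ (C₂ : ℝ) → 0ℝ <ℝ C₁ × 0ℝ <ℝ C₂ ×
    (∀ (t : ℕ) → t > 0 →
    ∀ (g : Vector ℂ n) → (∀ i → g i ≉ 0ℂ) →
    ∀ (f : Vector ℂ[x] n) → Admissible f → (∀ i → HasDegree (f i) (m i)) →
    ∀ (∣G∣ : ℕ) → HasCardinality (μ t) ∣G∣ →
    C₁ <ℝ fromℕ ∣G∣ →
    let instance 2n≢0 = 2n-nonZero n≥2 in
    CardinalityAtMost (λ x → ∀ i → coset (g i) (μ t) (eval (f i) x))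
    (C₂ *ℝ ∣G∣ ^[ n +ₙ 1 / 2 *ₙ n ]))
theorem3 (suc zero) (s≤s ())
theorem3 n@(suc (suc _)) n≥2 m m>0 =
  -- The second constant is the `degreeBound` of the first two polynomials, a function of their
  -- degrees alone; the power of |G| multiplying it is at least 1.
  1ℝ , fromℕ bound , 0<fromℕ 1 , 0<fromℕ bound {{ℕ.m*n≢0 _ _ {{ℕ.m^n≢0 2 (d₁ +ₙ suc d₂)}}}} ,
  λ t t>0 g g≉0 f ((x , root , noRoot) , _) degree ∣G∣ card _ xs inCosets distinct →
    let instance 2n≢0 = 2n-nonZero n≥2
                 ∣G∣≢0 = μ-nonEmpty t card
    in fromℕ≤scaledRoot {length xs} {bound}
      (ℕ.<⇒≤ (fewInCosets d₁ d₂ t>0 (g i₁) (g i₂) (f i₁) (f i₂) (g≉0 i₁)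
        (subst (HasDegree (f i₁)) (sym (suc-d i₁)) (degree i₁))
        (subst (HasDegree (f i₂)) (sym (suc-d i₂)) (degree i₂))
        -- Admissibility supplies the point where f₁ vanishes and f₂ does not.
        (x i₁) (root i₁) (noRoot i₁ i₂ λ ()) xs distinct (All.map (λ h → h i₁ , h i₂) inCosets)))
      (2 *ₙ n) {{2n≢0}} (∣G∣ ℕ.^ (n +ₙ 1)) {{ℕ.m^n≢0 ∣G∣ (n +ₙ 1)}}
  where
  i₁ i₂ : Fin n
  i₁ = Fin.zero
  i₂ = Fin.suc Fin.zero
  -- Predecessors of the degrees, because `fewInCosets` takes degrees in successor form; in
  -- `Sylvester` the names `d₁`, `d₂` stand for the degrees themselves.
  d₁ d₂ bound : ℕ
  d₁ = ℕ.pred (m i₁)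
  d₂ = ℕ.pred (m i₂)
  bound = 2 ℕ.^ (d₁ +ₙ suc d₂) *ₙ suc (suc d₁ +ₙ suc d₂)
  suc-d : ∀ i → suc (ℕ.pred (m i)) ≡ m i
  suc-d i = ℕ.suc-pred (m i) {{ℕ.>-nonZero (m>0 i)}}
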